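{- For all $p,q\in T$ such that $p\mathrel{\underline{\leftrightarrow}}q$ (that is, $p$ and $q$ are bisimilar), it holds that $p=q$ (that is, the equality of $p$ and $q$ is derivable from the axiom system).
   Context: Let $A$ be a set of actions (not necessarily finite). The set $T$ of (closed) process terms is defined inductively by $T::=0\mid a\ (a\in A)\mid T+T\mid T\cdot T\mid T^{*}T$, where $p^{*}q$ denotes the binary Kleene star applied to $p$ and $q$. The star binds stronger than $\cdot$, which binds stronger than $+$; $\cdot$ associates to the right. Let $\sqrt{}$ be a special termination symbol not in $T$, and $V=T\cup\{\sqrt{}\}$. The transition relation $\longrightarrow\subseteq V\times A\times V$, written $x\stackrel{a}{\longrightarrow}y$, is the least relation closed under the following rules ($p,q,p'\in T$, $v\in V$, $a\in A$): $a\stackrel{a}{\longrightarrow}\sqrt{}$; if $p\stackrel{a}{\longrightarrow}v$ then $p+q\stackrel{a}{\longrightarrow}v$; if $q\stackrel{a}{\longrightarrow}v$ then $p+q\stackrel{a}{\longrightarrow}v$; if $p\stackrel{a}{\longrightarrow}p'$ then $p\cdot q\stackrel{a}{\longrightarrow}p'\cdot q$; if $p\stackrel{a}{\longrightarrow}\sqrt{}$ then $p\cdot q\stackrel{a}{\longrightarrow}q$; if $p\stackrel{a}{\longrightarrow}p'$ then $p^{*}q\stackrel{a}{\longrightarrow}p'\cdot(p^{*}q)$; if $p\stackrel{a}{\longrightarrow}\sqrt{}$ then $p^{*}q\stackrel{a}{\longrightarrow}p^{*}q$; if $q\stackrel{a}{\longrightarrow}v$ then $p^{*}q\stackrel{a}{\longrightarrow}v$.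 Elements $u,v\in V$ are bisimilar, written $u\mathrel{\underline{\leftrightarrow}}v$, if there is a relation $R\subseteq V\times V$ with $(u,v)\in R$ such that for all $(x,y)\in R$: (1) $x=\sqrt{}$ iff $y=\sqrt{}$; (2) for all $x\stackrel{a}{\longrightarrow}x'$ there is $y'\in V$ with $y\stackrel{a}{\longrightarrow}y'$ and $(x',y')\in R$; (3) for all $y\stackrel{a}{\longrightarrow}y'$ there is $x'\in V$ with $x\stackrel{a}{\longrightarrow}x'$ and $(x',y')\in R$. For terms $p,q\in T$, $p=q$ denotes axiomatic equality: the least equivalence relation on $T$ that is a congruence for $+$, $\cdot$ and ${}^{*}$, contains all instances ($x,y,z\in T$) of (B1) $x+y=y+x$; (B2) $(x+y)+z=x+(y+z)$; (B3) $x+x=x$; (B4) $(x+y)\cdot z=x\cdot z+y\cdot z$; (B5) $(x\cdot y)\cdot z=x\cdot(y\cdot z)$; (B6) $x+0=x$; (B7) $0\cdot x=0$; (BKS1) $x\cdot(x^{*}y)+y=x^{*}y$; (BKS2) $(x^{*}y)\cdot z=x^{*}(y\cdot z)$; and is closed under the rule (RSP): $x=y\cdot x+z$ implies $x=y^{*}z$. -}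

module Defs where

open import Function.Bundles using (_⇔_)
open import Data.Product using (∃-syntax; _×_)
open import Level using (Level; suc)
open import Relation.Binary.Core using (Rel)
open import Relation.Binary.PropositionalEquality using (_≡_)

private
  variable
    ℓ : Level

-- p * q is the binary Kleene star: iterate p, then exit through q.
infixl 6 _+_
infixr 7 _·_
infixr 8 _*_

data Term (A : Set ℓ) : Set ℓ where
  𝟘   : Term A
  act : A → Term A
  _+_ : Term A → Term A → Term A
  _·_ : Term A → Term A → Term A
  _*_ : Term A → Term A → Term A

data State (A : Set ℓ) : Set ℓ where
  √    : State A
  term : Term A → State A

infix 4 _⟶[_]_

data _⟶[_]_ {A : Set ℓ} : State A → A → State A → Set ℓ where
  act-done : ∀ {a} → term (act a) ⟶[ a ] √
  +-left   : ∀ {p q a v} → term p ⟶[ a ] v → term (p + q) ⟶[ a ] v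
  +-right  : ∀ {p q a v} → term q ⟶[ a ] v → term (p + q) ⟶[ a ] v
  ·-step   : ∀ {p q a p′} → term p ⟶[ a ] term p′ → term (p · q) ⟶[ a ] term (p′ · q)
  ·-done   : ∀ {p q a} → term p ⟶[ a ] √ → term (p · q) ⟶[ a ] term q
  *-step   : ∀ {p q a p′} → term p ⟶[ a ] term p′ → term (p * q) ⟶[ a ] term (p′ · (p * q))
  *-loop   : ∀ {p q a} → term p ⟶[ a ] √ → term (p * q) ⟶[ a ] term (p * q)
  *-exit   : ∀ {p q a v} → term q ⟶[ a ] v → term (p * q) ⟶[ a ] v

record IsBisimulation {A : Set ℓ} (R : Rel (State A) ℓ) : Set ℓ where
  field
    termination : ∀ {x y} → R x y → (x ≡ √) ⇔ (y ≡ √)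
    forth : ∀ {x y a x′} → R x y → x ⟶[ a ] x′ → ∃[ y′ ] (y ⟶[ a ] y′ × R x′ y′)
    back  : ∀ {x y a y′} → R x y → y ⟶[ a ] y′ → ∃[ x′ ] (x ⟶[ a ] x′ × R x′ y′)

infix 4 _↔_ _≈_

-- Fixing R at level ℓ loses nothing: inside a bisimulation at any other level,
-- the pairs reached from (u , v) by its own forth and back choices form a
-- bisimulation indexed by transitions, hence at level ℓ.
_↔_ : {A : Set ℓ} → Rel (State A) (suc ℓ)
_↔_ {ℓ} {A} u v = ∃[ R ] (IsBisimulation {ℓ} {A} R × R u v)

data _≈_ {A : Set ℓ} : Rel (Term A) ℓ where
  ≈-refl  : ∀ {x} → x ≈ x
  ≈-sym   : ∀ {x y} → x ≈ y → y ≈ x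
  ≈-trans : ∀ {x y z} → x ≈ y → y ≈ z → x ≈ z

  +-cong : ∀ {x x′ y y′} → x ≈ x′ → y ≈ y′ → x + y ≈ x′ + y′
  ·-cong : ∀ {x x′ y y′} → x ≈ x′ → y ≈ y′ → x · y ≈ x′ · y′
  *-cong : ∀ {x x′ y y′} → x ≈ x′ → y ≈ y′ → x * y ≈ x′ * y′

  B1 : ∀ x y → x + y ≈ y + x
  B2 : ∀ x y z → (x + y) + z ≈ x + (y + z)
  B3 : ∀ x → x + x ≈ x
  B4 : ∀ x y z → (x + y) · z ≈ x · z + y · z
  B5 : ∀ x y z → (x · y) · z ≈ x · (y · z)
  B6 : ∀ x → x + 𝟘 ≈ x
  B7 : ∀ x → 𝟘 · x ≈ 𝟘

  BKS1 : ∀ x y → x · (x * y) + y ≈ x * y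
  BKS2 : ∀ x y z → (x * y) · z ≈ x * (y · z)

  RSP : ∀ {x y z} → x ≈ y · x + z → x ≈ y * z

{-# OPTIONS --safe #-}

-- Call a term rigid if every term bisimilar to it is provably equal to it, and good if all terms
-- reachable from it are rigid. The claim is that all terms are good.
--
-- Uniqueness: let D be a set of terms, each provably a sum of prefixes of members of D, in which bisimilar
-- members are provably equal. Then the members of D are good. Indeed, for k in D, induction on u shows that
-- u · k is provably a sum of prefixes of members of D as soon as its successors are bisimilar to members of D;
-- in the case of a star the member of D bisimilar to it solves the recursive equation, and RSP applies.
--
-- Existence: it remains to find such a D up to bisimilarity for a loop e * r with r good. The body e is
-- traversed, and a state is named only if it is not bisimilar to one named before. This keeps the shape of a
-- term, unless some state x · h in the body of an inner loop h = u * (v · (e * r)) is bisimilar to e * r;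
-- but then h ∼ (u + v · x) * 𝟘, which is a loop whose body has simpler inner loops, and e * r is reachable from h.
module Submission where

open import Defs
open import Data.Empty using (⊥)
open import Data.Fin.Base using (Fin; zero; suc; punchIn; punchOut; splitAt; _↑ˡ_; _↑ʳ_)
import Data.Fin.Properties as Fin
open import Data.List.Base using (List; []; _∷_; _++_; map; filter; length; cartesianProduct)
open import Data.List.Membership.Propositional using (_∈_; find; lose)
open import Data.List.Membership.Propositional.Properties
  using (∈-map⁺; ∈-map⁻; ∈-++⁺ˡ; ∈-++⁺ʳ; ∈-++⁻; ∈-filter⁺; ∈-cartesianProduct⁺)
open import Data.List.Properties using (filter-notAll)
open import Data.List.Relation.Unary.All as All using (All; []; _∷_)
open import Data.List.Relation.Unary.All.Properties as All using (¬All⇒Any¬)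
open import Data.List.Relation.Unary.Any as Any using (here; there)
open import Data.Nat.Base as ℕ using (ℕ; zero; suc; _≤_; _<_)
open import Data.Nat.Induction using (<-wellFounded)
import Data.Nat.Properties as ℕ
open import Data.Product using (_×_; _,_; ∃-syntax; proj₂; uncurry)
open import Data.Sum as Sum using (_⊎_; inj₁; inj₂; [_,_]′)
open import Data.Unit using (⊤; tt)
open import Function.Base using (_∘_; case_of_; id)
open import Function.Bundles using (Equivalence)
open import Induction.WellFounded using (Acc; acc)
open import Level using (Level; 0ℓ; _⊔_)
open import Relation.Binary.Bundles using (Setoid)
open import Relation.Binary.Core using (Rel)
open import Relation.Binary.Definitions using (DecidableEquality)
open import Relation.Binary.PropositionalEquality
  using (_≡_; refl; sym; trans; cong; cong₂; subst; subst₂)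
import Relation.Binary.Reasoning.Setoid as SetoidReasoning
open import Relation.Nullary.Decidable using (Dec; yes; no; map′; ¬?; _×-dec_; _⊎-dec_; decidable-stable)
open import Relation.Nullary.Negation using (¬_; contradiction)

-- Stabilisation of decreasing predicates on a finite list.

module _ {X : Set} (P : ℕ → X → Set) (P? : ∀ n x → Dec (P n x))
         (antitone : ∀ {n x} → P (suc n) x → P n x) where

  -- The candidates `ys` include every entry that satisfies `P n`. Either all candidates satisfy
  -- `P (suc n)`, or filtering by it makes the list strictly shorter.
  stabilise : ∀ xs → ∃[ m ] (∀ {x} → x ∈ xs → P m x → P (suc m) x)
  stabilise xs = go 0 xs (<-wellFounded _) (λ i _ → i)
    where
    go : ∀ n ys → Acc ℕ._<_ (length ys) → (∀ {x} → x ∈ xs → P n x → x ∈ ys) →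
         ∃[ m ] (∀ {x} → x ∈ xs → P m x → P (suc m) x)
    go n ys (acc rec) cover with All.all? (P? (suc n)) ys
    ... | yes all = n , λ i p → All.lookup all (cover i p)
    ... | no ¬all = go (suc n) (filter (P? (suc n)) ys)
      (rec (filter-notAll _ ys (¬All⇒Any¬ (P? (suc n)) ys ¬all)))
      (λ i p → ∈-filter⁺ (P? (suc n)) (cover i (antitone p)) p)

-- Inversion of transitions.

module _ {ℓ : Level} {A : Set ℓ} where

  private
    variable
      a : A
      p q : Term A
      s v : State A

  -- Lets the two rules for ·, and likewise the two rules for the body of *, be treated as one.
  infixr 7 _▸_

  _▸_ : State A → Term A → Term A
  √ ▸ y = y
  term x ▸ y = x · y

  ·-move : term p ⟶[ a ] s → term (p · q) ⟶[ a ] term (s ▸ q)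
  ·-move {s = √} = ·-done
  ·-move {s = term _} = ·-step

  *-move : term p ⟶[ a ] s → term (p * q) ⟶[ a ] term (s ▸ p * q)
  *-move {s = √} = *-loop
  *-move {s = term _} = *-step

  data ·-Move (p : Term A) (a : A) (q : Term A) : State A → Set ℓ where
    move : term p ⟶[ a ] s → ·-Move p a q (term (s ▸ q))

  ·-inv : term (p · q) ⟶[ a ] v → ·-Move p a q v
  ·-inv (·-step p⟶) = move p⟶
  ·-inv (·-done p⟶) = move p⟶

  data *-Move (p : Term A) (a : A) (q : Term A) : State A → Set ℓ where
    body : term p ⟶[ a ] s → *-Move p a q (term (s ▸ p * q))
    exit : term q ⟶[ a ] v → *-Move p a q v

  *-inv : term (p * q) ⟶[ a ] v → *-Move p a q v
  *-inv (*-step p⟶) = body p⟶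
  *-inv (*-loop p⟶) = body p⟶
  *-inv (*-exit q⟶) = exit q⟶

-- Bisimilarity through finite approximations, and soundness of the axioms.

module _ {A : Set} where

  private
    variable
      n : ℕ
      a : A
      k p p′ q q′ r x y z : Term A
      s t u v : State A
      l l′ : List (A × State A)

  ≈-setoid : Setoid 0ℓ 0ℓ
  ≈-setoid = record
    { Carrier = Term A
    ; _≈_ = _≈_
    ; isEquivalence = record { refl = ≈-refl ; sym = ≈-sym ; trans = ≈-trans }
    }

  module ≈-Reasoning = SetoidReasoning ≈-setoid

  infix 4 _~[_]_ _≃_ _∼_

  data _~[_]_ : State A → ℕ → State A → Set where
    any  : s ~[ zero ] t
    stop : √ ~[ suc n ] √
    step : (∀ {a v} → term p ⟶[ a ] v → ∃[ w ] (term q ⟶[ a ] w × v ~[ n ] w)) →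
           (∀ {a w} → term q ⟶[ a ] w → ∃[ v ] (term p ⟶[ a ] v × v ~[ n ] w)) →
           term p ~[ suc n ] term q

  ~-refl : s ~[ n ] s
  ~-refl {n = zero} = any
  ~-refl {√} {suc n} = stop
  ~-refl {term p} {suc n} = step (λ p⟶ → _ , p⟶ , ~-refl) (λ p⟶ → _ , p⟶ , ~-refl)

  ~-sym : s ~[ n ] t → t ~[ n ] s
  ~-sym any = any
  ~-sym stop = stop
  ~-sym (step f g) = step
    (λ q⟶ → let _ , p⟶ , e = g q⟶ in _ , p⟶ , ~-sym e)
    (λ p⟶ → let _ , q⟶ , e = f p⟶ in _ , q⟶ , ~-sym e)

  ~-trans : s ~[ n ] t → t ~[ n ] u → s ~[ n ] u
  ~-trans any any = any
  ~-trans stop stop = stop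
  ~-trans (step f g) (step f′ g′) = step
    (λ p⟶ → let _ , q⟶ , e = f p⟶; _ , r⟶ , e′ = f′ q⟶ in _ , r⟶ , ~-trans e e′)
    (λ r⟶ → let _ , q⟶ , e = g′ r⟶; _ , p⟶ , e′ = g q⟶ in _ , p⟶ , ~-trans e′ e)

  ~-pred : s ~[ suc n ] t → s ~[ n ] t
  ~-pred {n = zero} _ = any
  ~-pred {n = suc n} stop = stop
  ~-pred {n = suc n} (step f g) = step
    (λ p⟶ → let _ , q⟶ , e = f p⟶ in _ , q⟶ , ~-pred e)
    (λ q⟶ → let _ , p⟶ , e = g q⟶ in _ , p⟶ , ~-pred e)

  -- Bisimilarity as the limit of its finite approximations. Terms branch finitely, so the limit is
  -- itself a bisimulation; `forth` shows this for decidable equality of actions.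
  record _≃_ (s t : State A) : Set where
    constructor limit
    field at : ∀ n → s ~[ n ] t

  open _≃_ public

  _∼_ : Term A → Term A → Set
  p ∼ q = term p ≃ term q

  ≃-refl : s ≃ s
  ≃-refl = limit λ _ → ~-refl

  ≃-sym : s ≃ t → t ≃ s
  ≃-sym e = limit λ n → ~-sym (at e n)

  ≃-trans : s ≃ t → t ≃ u → s ≃ u
  ≃-trans e e′ = limit λ n → ~-trans (at e n) (at e′ n)

  ∼-setoid : Setoid 0ℓ 0ℓ
  ∼-setoid = record
    { Carrier = Term A
    ; _≈_ = _∼_
    ; isEquivalence = record { refl = ≃-refl ; sym = ≃-sym ; trans = ≃-trans }
    }

  module ∼-Reasoning = SetoidReasoning ∼-setoid

  +-~ : term p ~[ n ] term p′ → term q ~[ n ] term q′ → term (p + q) ~[ n ] term (p′ + q′)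
  +-~ any any = any
  +-~ (step f g) (step f′ g′) = step
    (λ { (+-left p⟶) → let _ , m , e = f p⟶ in _ , +-left m , e
       ; (+-right q⟶) → let _ , m , e = f′ q⟶ in _ , +-right m , e })
    (λ { (+-left p⟶) → let _ , m , e = g p⟶ in _ , +-left m , e
       ; (+-right q⟶) → let _ , m , e = g′ q⟶ in _ , +-right m , e })

  ▸-~ : ∀ n → s ~[ n ] t → term p ~[ n ] term q → term (s ▸ p) ~[ n ] term (t ▸ q)
  ▸-~ zero _ _ = any
  ▸-~ (suc n) stop e = e
  ▸-~ (suc n) (step f g) e = step
    (λ m → case ·-inv m of λ { (move p⟶) →
      let _ , m′ , d = f p⟶ in _ , ·-move m′ , ▸-~ n d (~-pred e) })
    (λ m → case ·-inv m of λ { (move p⟶) →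
      let _ , m′ , d = g p⟶ in _ , ·-move m′ , ▸-~ n d (~-pred e) })

  *-~ : ∀ n → term p ~[ n ] term p′ → term q ~[ n ] term q′ → term (p * q) ~[ n ] term (p′ * q′)
  *-~ zero _ _ = any
  *-~ (suc n) d@(step f g) e@(step f′ g′) = step
    (λ m → case *-inv m of λ
      { (body p⟶) → let _ , m′ , c = f p⟶ in _ , *-move m′ , ▸-~ n c (*-~ n (~-pred d) (~-pred e))
      ; (exit q⟶) → let _ , m′ , c = f′ q⟶ in _ , *-exit m′ , c })
    (λ m → case *-inv m of λ
      { (body p⟶) → let _ , m′ , c = g p⟶ in _ , *-move m′ , ▸-~ n c (*-~ n (~-pred d) (~-pred e))
      ; (exit q⟶) → let _ , m′ , c = g′ q⟶ in _ , *-exit m′ , c })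

  ·-assoc-~ : ∀ n s → term ((s ▸ p) · q) ~[ n ] term (s ▸ p · q)
  ·-assoc-~ n √ = ~-refl
  ·-assoc-~ zero (term _) = any
  ·-assoc-~ (suc n) (term x) = step
    (λ m → case ·-inv m of λ { (move m′) → case ·-inv m′ of λ { (move {s = s} x⟶) →
      _ , ·-move x⟶ , ·-assoc-~ n s } })
    (λ m → case ·-inv m of λ { (move {s = s} x⟶) →
      _ , ·-move (·-move x⟶) , ·-assoc-~ n s })

  *-·-~ : ∀ n → term ((p * q) · r) ~[ n ] term (p * (q · r))
  *-·-~ zero = any
  *-·-~ (suc n) = step
    (λ m → case ·-inv m of λ { (move m′) → case *-inv m′ of λ
      { (body {s = s} p⟶) → _ , *-move p⟶ , ~-trans (·-assoc-~ n s) (▸-~ n ~-refl (*-·-~ n))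
      ; (exit q⟶) → _ , *-exit (·-move q⟶) , ~-refl } })
    (λ m → case *-inv m of λ
      { (body {s = s} p⟶) → _ , ·-move (*-move p⟶) , ~-trans (·-assoc-~ n s) (▸-~ n ~-refl (*-·-~ n))
      ; (exit m′) → case ·-inv m′ of λ { (move q⟶) → _ , ·-move (*-exit q⟶) , ~-refl } })

  -- Every pass through `y` performs at least one action before `x` is entered again, so level
  -- `suc n` needs the claim for `x` only at level `n`.
  *-unique : x ∼ y · x + z → x ∼ y * z
  *-unique {x} {y} {z} e = limit go
    where
    go : ∀ n → term x ~[ n ] term (y * z)
    go zero = any
    go (suc n) with at e (suc n)
    ... | step f g = step
      (λ m → case f m of λ
        { (_ , +-left m′ , d) → case ·-inv m′ of λ { (move y⟶) →
            _ , *-move y⟶ , ~-trans d (▸-~ n ~-refl (go n)) }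
        ; (_ , +-right z⟶ , d) → _ , *-exit z⟶ , d })
      (λ m → case *-inv m of λ
        { (body y⟶) → let _ , m′ , d = g (+-left (·-move y⟶)) in
            _ , m′ , ~-trans d (▸-~ n ~-refl (go n))
        ; (exit z⟶) → g (+-right z⟶) })

  same-moves : (∀ {a v} → term p ⟶[ a ] v → term q ⟶[ a ] v) →
               (∀ {a v} → term q ⟶[ a ] v → term p ⟶[ a ] v) → p ∼ q
  same-moves {p} {q} f g = limit go
    where
    go : ∀ n → term p ~[ n ] term q
    go zero = any
    go (suc n) = step (λ m → _ , f m , ~-refl) (λ m → _ , g m , ~-refl)

  sound : p ≈ q → p ∼ q
  sound ≈-refl = ≃-refl
  sound (≈-sym e) = ≃-sym (sound e)
  sound (≈-trans e e′) = ≃-trans (sound e) (sound e′)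
  sound (+-cong e e′) = limit λ n → +-~ (at (sound e) n) (at (sound e′) n)
  sound (·-cong e e′) = limit λ n → ▸-~ n (at (sound e) n) (at (sound e′) n)
  sound (*-cong e e′) = limit λ n → *-~ n (at (sound e) n) (at (sound e′) n)
  sound (B1 x y) = same-moves
    (λ { (+-left m) → +-right m ; (+-right m) → +-left m })
    (λ { (+-left m) → +-right m ; (+-right m) → +-left m })
  sound (B2 x y z) = same-moves
    (λ { (+-left (+-left m)) → +-left m ; (+-left (+-right m)) → +-right (+-left m)
       ; (+-right m) → +-right (+-right m) })
    (λ { (+-left m) → +-left (+-left m) ; (+-right (+-left m)) → +-left (+-right m)
       ; (+-right (+-right m)) → +-right m })
  sound (B3 x) = same-moves (λ { (+-left m) → m ; (+-right m) → m }) +-left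
  sound (B4 x y z) = same-moves
    (λ { (·-step (+-left m)) → +-left (·-step m) ; (·-done (+-left m)) → +-left (·-done m)
       ; (·-step (+-right m)) → +-right (·-step m) ; (·-done (+-right m)) → +-right (·-done m) })
    (λ { (+-left (·-step m)) → ·-step (+-left m) ; (+-left (·-done m)) → ·-done (+-left m)
       ; (+-right (·-step m)) → ·-step (+-right m) ; (+-right (·-done m)) → ·-done (+-right m) })
  sound (B5 x y z) = limit λ n → ·-assoc-~ n (term x)
  sound (B6 x) = same-moves (λ { (+-left m) → m ; (+-right ()) }) +-left
  sound (B7 x) = same-moves (λ { (·-step ()) ; (·-done ()) }) (λ ())
  sound (BKS1 x y) = same-moves
    (λ { (+-left (·-step m)) → *-step m ; (+-left (·-done m)) → *-loop m ; (+-right m) → *-exit m })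
    (λ { (*-step m) → +-left (·-step m) ; (*-loop m) → +-left (·-done m) ; (*-exit m) → +-right m })
  sound (BKS2 x y z) = limit *-·-~
  sound (RSP e) = *-unique (sound e)

  ∼-+-cong : p ∼ p′ → q ∼ q′ → p + q ∼ p′ + q′
  ∼-+-cong e e′ = limit λ n → +-~ (at e n) (at e′ n)

  ▸-cong : s ≃ t → p ∼ q → s ▸ p ∼ t ▸ q
  ▸-cong e e′ = limit λ n → ▸-~ n (at e n) (at e′ n)

  ∼-·-cong : p ∼ p′ → q ∼ q′ → p · q ∼ p′ · q′
  ∼-·-cong = ▸-cong

  ∼-*-cong : p ∼ p′ → q ∼ q′ → p * q ∼ p′ * q′
  ∼-*-cong e e′ = limit λ n → *-~ n (at e n) (at e′ n)

  -- Every term is provably a finite sum of prefixes.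

  pre : A → State A → Term A
  pre a √ = act a
  pre a (term x) = act a · x

  ⨁ : List (A × State A) → Term A
  ⨁ [] = 𝟘
  ⨁ ((a , s) ∷ l) = pre a s + ⨁ l

  pre-move : term (pre a s) ⟶[ a ] s
  pre-move {s = √} = act-done
  pre-move {s = term _} = ·-done act-done

  pre-inv : ∀ {b} → term (pre a s) ⟶[ b ] v → a ≡ b × s ≡ v
  pre-inv {s = √} act-done = refl , refl
  pre-inv {s = term _} (·-done act-done) = refl , refl

  ⨁-move : (a , s) ∈ l → term (⨁ l) ⟶[ a ] s
  ⨁-move (here refl) = +-left pre-move
  ⨁-move (there i) = +-right (⨁-move i)

  ⨁-inv : ∀ l → term (⨁ l) ⟶[ a ] s → (a , s) ∈ l
  ⨁-inv (x ∷ l) (+-left m) with refl , refl ← pre-inv m = here refl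
  ⨁-inv (x ∷ l) (+-right m) = there (⨁-inv l m)

  pre-▸ : ∀ s → pre a s · k ≈ pre a (term (s ▸ k))
  pre-▸ √ = ≈-refl
  pre-▸ (term x) = B5 _ _ _

  then : Term A → A × State A → A × State A
  then k (a , s) = a , term (s ▸ k)

  ⨁-· : ∀ l k → ⨁ l · k ≈ ⨁ (map (then k) l)
  ⨁-· [] k = B7 k
  ⨁-· ((a , s) ∷ l) k = ≈-trans (B4 _ _ _) (+-cong (pre-▸ s) (⨁-· l k))

  +-identityˡ : 𝟘 + x ≈ x
  +-identityˡ = ≈-trans (B1 _ _) (B6 _)

  ⨁-++ : ∀ l {l′} → ⨁ l + ⨁ l′ ≈ ⨁ (l ++ l′)
  ⨁-++ [] = +-identityˡ
  ⨁-++ (x ∷ l) = ≈-trans (B2 _ _ _) (+-cong ≈-refl (⨁-++ l))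

  moves : Term A → List (A × State A)
  moves 𝟘 = []
  moves (act a) = (a , √) ∷ []
  moves (p + q) = moves p ++ moves q
  moves (p · q) = map (then q) (moves p)
  moves (p * q) = map (then (p * q)) (moves p) ++ moves q

  ⨁-moves : ∀ p → p ≈ ⨁ (moves p)
  ⨁-moves 𝟘 = ≈-refl
  ⨁-moves (act a) = ≈-sym (B6 _)
  ⨁-moves (p + q) = ≈-trans (+-cong (⨁-moves p) (⨁-moves q)) (⨁-++ (moves p))
  ⨁-moves (p · q) = ≈-trans (·-cong (⨁-moves p) ≈-refl) (⨁-· (moves p) q)
  ⨁-moves (p * q) = begin
    p * q ≈⟨ BKS1 p q ⟨
    p · (p * q) + q ≈⟨ +-cong (·-cong (⨁-moves p) ≈-refl) (⨁-moves q) ⟩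
    ⨁ (moves p) · (p * q) + ⨁ (moves q) ≈⟨ +-cong (⨁-· (moves p) _) ≈-refl ⟩
    ⨁ (map (then (p * q)) (moves p)) + ⨁ (moves q) ≈⟨ ⨁-++ (map _ (moves p)) ⟩
    ⨁ (moves (p * q)) ∎
    where open ≈-Reasoning

  moves-complete : term p ⟶[ a ] v → (a , v) ∈ moves p
  moves-complete act-done = here refl
  moves-complete (+-left m) = ∈-++⁺ˡ (moves-complete m)
  moves-complete (+-right m) = ∈-++⁺ʳ _ (moves-complete m)
  moves-complete (·-step m) = ∈-map⁺ _ (moves-complete m)
  moves-complete (·-done m) = ∈-map⁺ _ (moves-complete m)
  moves-complete (*-step m) = ∈-++⁺ˡ (∈-map⁺ _ (moves-complete m))
  moves-complete (*-loop m) = ∈-++⁺ˡ (∈-map⁺ _ (moves-complete m))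
  moves-complete (*-exit m) = ∈-++⁺ʳ _ (moves-complete m)

  moves-sound : ∀ p → (a , v) ∈ moves p → term p ⟶[ a ] v
  moves-sound (act a) (here refl) = act-done
  moves-sound (p + q) i with ∈-++⁻ (moves p) i
  ... | inj₁ j = +-left (moves-sound p j)
  ... | inj₂ j = +-right (moves-sound q j)
  moves-sound (p · q) i with _ , j , refl ← ∈-map⁻ (then q) i = ·-move (moves-sound p j)
  moves-sound (p * q) i with ∈-++⁻ (map (then (p * q)) (moves p)) i
  ... | inj₁ j with _ , j′ , refl ← ∈-map⁻ (then (p * q)) j = *-move (moves-sound p j′)
  moves-sound (p * q) i | inj₂ j = *-exit (moves-sound q j)

  -- A finite set of states closed under transitions.

  derivatives : Term A → List (Term A)
  derivatives 𝟘 = []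
  derivatives (act a) = []
  derivatives (p + q) = derivatives p ++ derivatives q
  derivatives (p · q) = map (_· q) (derivatives p) ++ q ∷ derivatives q
  derivatives (p * q) = map (_· (p * q)) (derivatives p) ++ (p * q) ∷ derivatives q

  derivatives-one : term p ⟶[ a ] term q → q ∈ derivatives p
  derivatives-one (+-left m) = ∈-++⁺ˡ (derivatives-one m)
  derivatives-one (+-right m) = ∈-++⁺ʳ _ (derivatives-one m)
  derivatives-one (·-step m) = ∈-++⁺ˡ (∈-map⁺ _ (derivatives-one m))
  derivatives-one {p · q} (·-done m) = ∈-++⁺ʳ (map _ (derivatives p)) (here refl)
  derivatives-one (*-step m) = ∈-++⁺ˡ (∈-map⁺ _ (derivatives-one m))
  derivatives-one {p * q} (*-loop m) = ∈-++⁺ʳ (map _ (derivatives p)) (here refl)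
  derivatives-one {p * q} (*-exit m) = ∈-++⁺ʳ (map _ (derivatives p)) (there (derivatives-one m))

  derivatives-step : ∀ p → q ∈ derivatives p → term q ⟶[ a ] term r → r ∈ derivatives p
  derivatives-step (p₁ + p₂) i m with ∈-++⁻ (derivatives p₁) i
  ... | inj₁ j = ∈-++⁺ˡ (derivatives-step p₁ j m)
  ... | inj₂ j = ∈-++⁺ʳ _ (derivatives-step p₂ j m)
  derivatives-step (p₁ · p₂) i m with ∈-++⁻ (map (_· p₂) (derivatives p₁)) i
  ... | inj₂ (here refl) = ∈-++⁺ʳ (map _ (derivatives p₁)) (there (derivatives-one m))
  ... | inj₂ (there j) = ∈-++⁺ʳ (map _ (derivatives p₁)) (there (derivatives-step p₂ j m))
  ... | inj₁ j with _ , j′ , refl ← ∈-map⁻ (_· p₂) j with m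
  ... | ·-step m′ = ∈-++⁺ˡ (∈-map⁺ _ (derivatives-step p₁ j′ m′))
  ... | ·-done m′ = ∈-++⁺ʳ (map _ (derivatives p₁)) (here refl)
  derivatives-step (p₁ * p₂) i m with ∈-++⁻ (map (_· (p₁ * p₂)) (derivatives p₁)) i
  ... | inj₂ (here refl) = derivatives-one m
  ... | inj₂ (there j) = ∈-++⁺ʳ (map _ (derivatives p₁)) (there (derivatives-step p₂ j m))
  ... | inj₁ j with _ , j′ , refl ← ∈-map⁻ (_· (p₁ * p₂)) j with m
  ... | ·-step m′ = ∈-++⁺ˡ (∈-map⁺ _ (derivatives-step p₁ j′ m′))
  ... | ·-done m′ = ∈-++⁺ʳ (map _ (derivatives p₁)) (here refl)

  -- May contain states that cannot be reached; what counts is that it is finite, contains both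
  -- terms and is closed under transitions.
  closure : Term A → Term A → List (State A)
  closure p q = √ ∷ map term ((p ∷ derivatives p) ++ q ∷ derivatives q)

  closure-step : ∀ p q → s ∈ closure p q → s ⟶[ a ] t → t ∈ closure p q
  closure-step {t = √} p q i m = here refl
  closure-step {t = term _} p q (here refl) ()
  closure-step {t = term _} p q (there i) m with _ , j , refl ← ∈-map⁻ term i =
    there (∈-map⁺ term ([ (λ { (here refl) → ∈-++⁺ˡ (there (derivatives-one m))
                             ; (there k) → ∈-++⁺ˡ (there (derivatives-step p k m)) })
                        , (λ { (here refl) → ∈-++⁺ʳ (p ∷ derivatives p) (there (derivatives-one m))
                             ; (there k) → ∈-++⁺ʳ (p ∷ derivatives p) (there (derivatives-step q k m)) })
                        ]′ (∈-++⁻ (p ∷ derivatives p) j)))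

  Stable : ℕ → List (State A) → Set
  Stable n l = ∀ {s t} → s ∈ l → t ∈ l → s ~[ n ] t → s ~[ suc n ] t

  -- On a list closed under transitions, a level that implies the next one is already a
  -- bisimulation, so it implies all levels.
  stable⇒~ : (l : List (State A)) → (∀ {s a t} → s ∈ l → s ⟶[ a ] t → t ∈ l) → Stable n l →
             s ∈ l → t ∈ l → s ~[ n ] t → ∀ m → s ~[ m ] t
  stable⇒~ l closed stable i j e zero = any
  stable⇒~ l closed stable i j e (suc m) with stable i j e
  ... | stop = stop
  ... | step f g = step
    (λ p⟶ → let _ , q⟶ , d = f p⟶ in
      _ , q⟶ , stable⇒~ l closed stable (closed i p⟶) (closed j q⟶) d m)
    (λ q⟶ → let _ , p⟶ , d = g q⟶ in
      _ , p⟶ , stable⇒~ l closed stable (closed i p⟶) (closed j q⟶) d m)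

-- Decidability of bisimilarity.

module Decidability {A : Set} (_≟_ : DecidableEquality A) where

  private
    variable
      a : A
      p q : Term A
      s t v : State A

  every-move? : ∀ p {Q : A → State A → Set} → (∀ a v → Dec (Q a v)) →
                Dec (∀ {a v} → term p ⟶[ a ] v → Q a v)
  every-move? p Q? = map′
    (λ all m → All.lookup all (moves-complete m))
    (λ f → All.tabulate λ i → f (moves-sound p i))
    (All.all? (uncurry Q?) (moves p))

  some-move? : ∀ p {Q : A → State A → Set} → (∀ a v → Dec (Q a v)) →
               Dec (∃[ a ] ∃[ v ] (term p ⟶[ a ] v × Q a v))
  some-move? p Q? = map′
    (λ x → let _ , i , q = find x in _ , _ , moves-sound p i , q)
    (λ (_ , _ , m , q) → lose (moves-complete m) q)
    (Any.any? (uncurry Q?) (moves p))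

  ~? : ∀ n s t → Dec (s ~[ n ] t)
  ~? zero s t = yes any
  ~? (suc n) √ √ = yes stop
  ~? (suc n) √ (term q) = no λ ()
  ~? (suc n) (term p) √ = no λ ()
  ~? (suc n) (term p) (term q) = map′ match unmatch
    (every-move? p (λ a v → some-move? q λ b w → a ≟ b ×-dec ~? n v w) ×-dec
     every-move? q (λ b w → some-move? p λ a v → a ≟ b ×-dec ~? n v w))
    where
    Matches : Set
    Matches =
      (∀ {a v} → term p ⟶[ a ] v → ∃[ b ] ∃[ w ] (term q ⟶[ b ] w × a ≡ b × v ~[ n ] w)) ×
      (∀ {b w} → term q ⟶[ b ] w → ∃[ a ] ∃[ v ] (term p ⟶[ a ] v × a ≡ b × v ~[ n ] w))

    match : Matches → term p ~[ suc n ] term q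
    match (f , g) = step
      (λ m → case f m of λ { (_ , _ , m′ , refl , e) → _ , m′ , e })
      (λ m → case g m of λ { (_ , _ , m′ , refl , e) → _ , m′ , e })

    unmatch : term p ~[ suc n ] term q → Matches
    unmatch (step f g) =
      (λ m → let _ , m′ , e = f m in _ , _ , m′ , refl , e) ,
      (λ m → let _ , m′ , e = g m in _ , _ , m′ , refl , e)

  -- The levels decrease on the finitely many pairs from the closure, so they stabilise, and a
  -- stable level is bisimilarity there.
  horizon : ∀ p q → ∃[ n ] (∀ {s t} → s ∈ closure p q → t ∈ closure p q → s ~[ n ] t → s ≃ t)
  horizon p q =
    let l = closure p q
        n , stable = stabilise (λ n → uncurry _~[ n ]_) (λ n → uncurry (~? n)) ~-pred (cartesianProduct l l)
    in n , λ i j e → limit (stable⇒~ l (closure-step p q) (λ i j → stable (∈-cartesianProduct⁺ i j)) i j e)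

  left∈closure : term p ∈ closure p q
  left∈closure = there (here refl)

  right∈closure : term q ∈ closure p q
  right∈closure {p = p} = there (∈-map⁺ term (∈-++⁺ʳ (p ∷ derivatives p) (here refl)))

  -- Non-bisimilarity comes with a separating level, so that refuting a given bisimulation takes an
  -- exploration to a finite depth only.
  bisimilar-or-separated : ∀ p q → p ∼ q ⊎ ∃[ n ] ¬ term p ~[ n ] term q
  bisimilar-or-separated p q with n , h ← horizon p q with ~? n (term p) (term q)
  ... | yes e = inj₁ (h left∈closure (right∈closure {p = p}) e)
  ... | no ¬e = inj₂ (n , ¬e)

  _∼?_ : ∀ p q → Dec (p ∼ q)
  p ∼? q with bisimilar-or-separated p q
  ... | inj₁ e = yes e
  ... | inj₂ (n , ¬e) = no λ e → ¬e (at e n)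

  -- A priori the matching move depends on the level. The move found at level `suc n`, for the
  -- horizon `n`, has a target related at level `n`, hence at all levels.
  forth : p ∼ q → term p ⟶[ a ] v → ∃[ w ] (term q ⟶[ a ] w × v ≃ w)
  forth {p} {q} e m with n , h ← horizon p q with step f _ ← at e (suc n) with _ , m′ , d ← f m =
    _ , m′ , h (closure-step p q left∈closure m) (closure-step p q (right∈closure {p = p}) m′) d

-- Uniqueness: goodness from a set of pairwise distinguishable states.

module Uniqueness {A : Set} (_≟_ : DecidableEquality A) where

  open Decidability _≟_ public

  private
    variable
      a : A
      k p q x x′ y z : Term A
      s t v : State A

  not-√ : ¬ term x ≃ √
  not-√ e with () ← at e 1

  forth-term : x ∼ y → term x ⟶[ a ] term x′ → ∃[ y′ ] (term y ⟶[ a ] term y′ × x′ ∼ y′)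
  forth-term e m with forth e m
  ... | √ , _ , d = contradiction d not-√
  ... | term _ , m′ , d = _ , m′ , d

  infixr 5 _◅_

  data Reach : Term A → Term A → Set where
    stay : Reach x x
    _◅_  : term x ⟶[ a ] term y → Reach y z → Reach x z

  reach-∼ : x ∼ x′ → Reach x y → ∃[ y′ ] (Reach x′ y′ × y ∼ y′)
  reach-∼ e stay = _ , stay , e
  reach-∼ e (m ◅ r) =
    let _ , m′ , d = forth-term e m
        _ , r′ , d′ = reach-∼ d r
    in _ , m′ ◅ r′ , d′

  reach-trans : Reach x y → Reach y z → Reach x z
  reach-trans stay r = r
  reach-trans (m ◅ r′) r = m ◅ reach-trans r′ r

  module _ {Q : Term A → Set} (Q? : ∀ x → Dec (Q x)) where

    data Within : ℕ → State A → Set where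
      now   : ∀ {n} → Q x → Within n (term x)
      later : ∀ {n} → term x ⟶[ a ] v → Within n v → Within (suc n) (term x)

    within? : ∀ n s → Dec (Within n s)
    within? n √ = no λ ()
    within? zero (term x) = map′ now (λ { (now q) → q }) (Q? x)
    within? (suc n) (term x) = map′
      [ now , (λ (_ , _ , m , r) → later m r) ]′
      (λ { (now q) → inj₁ q ; (later m r) → inj₂ (_ , _ , m , r) })
      (Q? x ⊎-dec some-move? x (λ _ → within? n))

    within-suc : ∀ {n s} → Within n s → Within (suc n) s
    within-suc (now q) = now q
    within-suc (later m r) = later m (within-suc r)

    within-sound : ∀ {n} → Within n (term x) → ∃[ y ] (Reach x y × Q y)
    within-sound (now q) = _ , stay , q
    within-sound (later {v = term _} m r) = let _ , r′ , q = within-sound r in _ , m ◅ r′ , q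

    some-reach? : ∀ x → Dec (∃[ y ] (Reach x y × Q y))
    -- It is the negation of `Within n` that decreases with `n`. Once it is stable on the closure,
    -- `n` steps find everything that is reachable.
    some-reach? x with stabilise (λ n s → ¬ Within n s) (λ n s → ¬? (within? n s)) (_∘ within-suc) (closure x x)
    ... | n , stable with within? n (term x)
    ... | yes r = yes (within-sound r)
    ... | no ¬r = no λ (_ , r , q) → ¬r (complete left∈closure r q)
      where
      complete : ∀ {x′ y} → term x′ ∈ closure x x → Reach x′ y → Q y → Within n (term x′)
      complete i stay q = now q
      complete i (m ◅ r) q = decidable-stable (within? n _) λ ¬w →
        stable i ¬w (later m (complete (closure-step x x i m) r q))

  Rigid : Term A → Set
  Rigid x = ∀ {p} → p ∼ x → p ≈ x

  Good : Term A → Set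
  Good x = ∀ {y} → Reach x y → Rigid y

  Goodˢ : State A → Set
  Goodˢ √ = ⊤
  Goodˢ (term x) = Good x

  rigid-∼ : x ∼ y → Rigid x → Rigid y
  rigid-∼ e rigid d = ≈-trans (rigid (≃-trans d (≃-sym e))) (≈-sym (rigid (≃-sym e)))

  good-∼ : x ∼ y → Good x → Good y
  good-∼ e good r = let _ , r′ , d = reach-∼ (≃-sym e) r in rigid-∼ (≃-sym d) (good r′)

  good-reach : Reach x y → Good x → Good y
  good-reach r good r′ = good (reach-trans r r′)

  good-move : term x ⟶[ a ] s → Good x → Goodˢ s
  good-move {s = √} _ _ = tt
  good-move {s = term _} m good = good-reach (m ◅ stay) good

  Expands : (State A → Set) → Term A → Set
  Expands D x = ∃[ l ] (x ≈ ⨁ l × All (D ∘ proj₂) l)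

  expands-≈ : ∀ {D} → x ≈ y → Expands D x → Expands D y
  expands-≈ e (l , d , all) = l , ≈-trans (≈-sym e) d , all

  expands-+ : ∀ {D} → Expands D x → Expands D y → Expands D (x + y)
  expands-+ (l , e , all) (l′ , e′ , all′) =
    l ++ l′ , ≈-trans (+-cong e e′) (⨁-++ l) , All.++⁺ all all′

  expands-mono : ∀ {D E} → (∀ {s} → D s → E s) → Expands D x → Expands E x
  expands-mono f (l , e , all) = l , e , All.map f all

  expands-▸ : ∀ {D E} → (∀ {s} → D s → E (term (s ▸ k))) → Expands D x → Expands E (x · k)
  expands-▸ {k = k} f (l , e , all) =
    map (then k) l , ≈-trans (·-cong e ≈-refl) (⨁-· l k) , All.map⁺ (All.map f all)

  expands-moves : ∀ {D} p → (∀ {a s} → term p ⟶[ a ] s → D s) → Expands D p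
  expands-moves p f = moves p , ⨁-moves p , All.tabulate λ i → f (moves-sound p i)

  expands-inv : ∀ {D} → Expands D x → term x ⟶[ a ] v → ∃[ d ] (D d × v ≃ d)
  expands-inv (l , e , all) m =
    let d , m′ , c = forth (sound e) m in d , All.lookup all (⨁-inv l m′) , c

  ⨁-summand : ∀ {l} → (a , s) ∈ l → ⨁ l + pre a s ≈ ⨁ l
  ⨁-summand (here refl) =
    ≈-trans (+-cong (B1 _ _) ≈-refl) (≈-trans (B2 _ _ _) (≈-trans (+-cong ≈-refl (B3 _)) (B1 _ _)))
  ⨁-summand (there i) = ≈-trans (B2 _ _ _) (+-cong ≈-refl (⨁-summand i))

  pre-cong : x ≈ y → pre a (term x) ≈ pre a (term y)
  pre-cong e = ·-cong ≈-refl e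

  ⨁-absorb : ∀ l → All (λ (a , s) → x + pre a s ≈ x) l → x + ⨁ l ≈ x
  ⨁-absorb [] [] = B6 _
  ⨁-absorb ((a , s) ∷ l) (e ∷ all) = ≈-trans (≈-sym (B2 _ _ _)) (≈-trans (+-cong e ≈-refl) (⨁-absorb l all))

  -- Terms that can terminate, and terms that absorb their continuation.

  data Halts : Term A → Set where
    act : Halts (act a)
    +ˡ  : Halts x → Halts (x + y)
    +ʳ  : Halts y → Halts (x + y)
    _·_ : Halts x → Halts y → Halts (x · y)
    *ʳ  : Halts y → Halts (x * y)

  halts? : ∀ x → Dec (Halts x)
  halts? 𝟘 = no λ ()
  halts? (act a) = yes act
  halts? (x + y) = map′ [ +ˡ , +ʳ ]′ (λ { (+ˡ h) → inj₁ h ; (+ʳ h) → inj₂ h }) (halts? x ⊎-dec halts? y)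
  halts? (x · y) = map′ (uncurry _·_) (λ { (h · h′) → h , h′ }) (halts? x ×-dec halts? y)
  halts? (x * y) = map′ *ʳ (λ { (*ʳ h) → h }) (halts? y)

  mute : ∀ x → ¬ Halts x → x · y ≈ x
  mute 𝟘 ¬h = B7 _
  mute (act a) ¬h = contradiction act ¬h
  mute (x + y) ¬h = ≈-trans (B4 _ _ _) (+-cong (mute x (¬h ∘ +ˡ)) (mute y (¬h ∘ +ʳ)))
  mute (x · y) ¬h with halts? x
  ... | yes h = ≈-trans (B5 _ _ _) (·-cong ≈-refl (mute y (¬h ∘ (h ·_))))
  ... | no ¬h′ = ≈-trans (B5 _ _ _) (≈-trans (mute x ¬h′) (≈-sym (mute x ¬h′)))
  mute (x * y) ¬h = ≈-trans (BKS2 _ _ _) (*-cong ≈-refl (mute y (¬h ∘ *ʳ)))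

  -- A run of `x` to `√` leads from `x · y` to `y`, and `Q` is carried along it. Such a run has at
  -- least one step, so `Q` is asked of the successors of `x · y` only. Respect for `≃` is needed to
  -- reassociate products on the way.
  halts-▸ : {Q : State A → Set} → (∀ {s t} → s ≃ t → Q s → Q t) →
            (∀ {x a v} → Q (term x) → term x ⟶[ a ] v → Q v) →
            Halts x → (∀ {a v} → term (x · y) ⟶[ a ] v → Q v) → Q (term y)
  halts-▸ {Q = Q} resp next = go
    where
    go : Halts x → (∀ {a v} → term (x · y) ⟶[ a ] v → Q v) → Q (term y)
    go act f = f (·-done act-done)
    go (+ˡ h) f = go h λ m → case ·-inv m of λ { (move m′) → f (·-move (+-left m′)) }
    go (+ʳ h) f = go h λ m → case ·-inv m of λ { (move m′) → f (·-move (+-right m′)) }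
    go (h · h′) f = go h′ λ m → next
      (go h λ m′ → let _ , m″ , e = forth (sound (≈-sym (B5 _ _ _))) m′ in resp (≃-sym e) (f m″)) m
    go (*ʳ h) f = go h λ m → case ·-inv m of λ { (move m′) → f (·-move (*-exit m′)) }

  infixr 7 _▹_

  -- Treats a term on its own and a term with a continuation alike, so that the inductions on a term
  -- can start from `√`.
  _▹_ : Term A → State A → Term A
  x ▹ √ = x
  x ▹ term k = x · k

  ▹-+ : ∀ s → (x + y) ▹ s ≈ x ▹ s + y ▹ s
  ▹-+ √ = ≈-refl
  ▹-+ (term k) = B4 _ _ _

  ▹-· : ∀ s → (x · y) ▹ s ≈ x · (y ▹ s)
  ▹-· √ = ≈-refl
  ▹-· (term k) = B5 _ _ _

  ▹-* : ∀ s → (x * y) ▹ s ≈ x * (y ▹ s)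
  ▹-* √ = ≈-refl
  ▹-* (term k) = BKS2 _ _ _

  mute-▹ : ∀ x s → ¬ Halts x → x ▹ s ≈ x
  mute-▹ x √ ¬h = ≈-refl
  mute-▹ x (term k) ¬h = mute x ¬h

  -- Solving equations in a collapsed set.

  record Collapsed (D : State A → Set) : Set where
    field
      done     : D √
      expand   : D (term x) → Expands D x
      collapse : D (term x) → D (term y) → x ∼ y → x ≈ y

    Near : State A → Set
    Near s = ∃[ d ] (D d × s ≃ d)

    near-∼ : s ≃ t → Near s → Near t
    near-∼ e (d , i , e′) = d , i , ≃-trans (≃-sym e) e′

    near-next : Near (term x) → term x ⟶[ a ] v → Near v
    near-next (√ , _ , e) _ = contradiction e not-√
    near-next (term d , i , e) m =
      let w , m′ , e′ = forth e m
      in near-∼ (≃-sym e′) (expands-inv (expand i) m′)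

    collapseˢ : D s → D t → s ≃ t → pre a s ≈ pre a t
    collapseˢ {√} {√} _ _ _ = ≈-refl
    collapseˢ {√} {term _} _ _ e = contradiction (≃-sym e) not-√
    collapseˢ {term _} {√} _ _ e = contradiction e not-√
    collapseˢ {term _} {term _} i j e = pre-cong (collapse i j e)

    -- Each prefix of `y` is matched by a prefix of `x` with a bisimilar target. Both targets lie in
    -- `D`, so the prefixes are provably equal and the one of `y` is absorbed.
    absorbs : Expands D x → Expands D y → y ∼ x → x + y ≈ x
    absorbs {x} {y} (l , e , all) (l′ , e′ , all′) d =
      ≈-trans (+-cong ≈-refl e′) (⨁-absorb l′ (All.tabulate λ {as} i →
        let _ , m , c = forth (≃-trans (≃-sym (sound e′)) (≃-trans d (sound e))) (⨁-move i)
            j = ⨁-inv l m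
        in ≈-trans (+-cong e (collapseˢ (All.lookup all′ i) (All.lookup all j) c))
                   (≈-trans (⨁-summand j) (≈-sym e))))

    expands-collapse : Expands D x → Expands D y → x ∼ y → x ≈ y
    expands-collapse i j e =
      ≈-trans (≈-sym (absorbs i j (≃-sym e))) (≈-trans (B1 _ _) (absorbs j i e))

    NearMoves : Term A → Set
    NearMoves x = ∀ {a v} → term x ⟶[ a ] v → Near v

    near-moves-∼ : x ∼ y → NearMoves x → NearMoves y
    near-moves-∼ e f m = let _ , m′ , d = forth (≃-sym e) m in near-∼ (≃-sym d) (f m′)

    -- The continuation remains a member of `D` throughout the induction. If `u` can halt, what
    -- follows it is bisimilar to some member `y`; for a product the two are provably equal, as both
    -- expand, and `y` becomes the continuation. If `u` cannot halt, it absorbs any continuation,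
    -- and `s` will do.
    solve : ∀ u s → D s → NearMoves (u ▹ s) → Expands D (u ▹ s)
    solve 𝟘 √ i f = [] , ≈-refl , []
    solve 𝟘 (term k) i f = [] , B7 k , []
    solve (act a) √ i f = (a , √) ∷ [] , ≈-sym (B6 _) , i ∷ []
    solve (act a) (term k) i f = (a , term k) ∷ [] , ≈-sym (B6 _) , i ∷ []
    solve (u + v) s i f = expands-≈ (≈-sym (▹-+ s)) (expands-+
      (solve u s i (λ m → f′ (+-left m))) (solve v s i (λ m → f′ (+-right m))))
      where
      f′ : NearMoves (u ▹ s + v ▹ s)
      f′ = near-moves-∼ (sound (▹-+ s)) f
    solve (u · v) s i f with near-moves-∼ (sound (▹-· {u} {v} s)) f | halts? u
    ... | f′ | no ¬h =
      let e = ≈-trans (▹-· s) (≈-trans (mute u ¬h) (≈-sym (mute-▹ u s ¬h))) in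
      expands-≈ (≈-sym e) (solve u s i (near-moves-∼ (sound e) f))
    ... | f′ | yes h with halts-▸ near-∼ near-next h f′
    ... | √ , _ , e = contradiction e not-√
    ... | near@(term y , j , e) =
      let v≈y = expands-collapse (solve v s i (near-next near)) (expand j) e
          u·v≈u·y = ≈-trans (▹-· s) (·-cong ≈-refl v≈y)
      in expands-≈ (≈-sym u·v≈u·y) (solve u (term y) j (near-moves-∼ (sound u·v≈u·y) f))
    solve (u * v) s i f with near-moves-∼ (sound (≈-trans (▹-* {u} {v} s) (≈-sym (BKS1 _ _)))) f | halts? u
    ... | f′ | no ¬h =
      let e = ≈-trans (mute u ¬h) (≈-sym (mute-▹ u s ¬h)) in
      expands-≈ (≈-trans (+-cong (≈-sym e) ≈-refl) (≈-trans (BKS1 _ _) (≈-sym (▹-* s))))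
        (expands-+ (solve u s i (near-moves-∼ (sound e) (f′ ∘ +-left))) (solve v s i (f′ ∘ +-right)))
    ... | f′ | yes h with halts-▸ near-∼ near-next h (f′ ∘ +-left)
    ... | √ , _ , e = contradiction e not-√
    -- Here `y` is bisimilar to the loop itself, hence to `u · y + v ▹ s`. Both of these expand in
    -- `D`, so they are provably equal, and `RSP` identifies `y` with the loop.
    ... | near@(term y , j , e) =
      let d = ∼-·-cong ≃-refl e
          uy+v = expands-+ (solve u (term y) j (near-moves-∼ d (f′ ∘ +-left))) (solve v s i (f′ ∘ +-right))
          y≈uy+v = expands-collapse (expand j) uy+v
            (≃-trans (≃-sym e) (≃-trans (sound (≈-sym (BKS1 _ _))) (∼-+-cong d ≃-refl)))
      in expands-≈ (≈-trans (RSP y≈uy+v) (≈-sym (▹-* s))) (expand j)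

    rigid : D (term x) → Rigid x
    rigid i e = expands-collapse (solve _ √ done (near-next (_ , i , e))) (expand i) e

    near-rigid : Near (term x) → Rigid x
    near-rigid (√ , _ , e) = contradiction e not-√
    near-rigid (term _ , i , e) = rigid-∼ (≃-sym e) (rigid i)

    near-good : Near (term x) → Good x
    near-good near stay = near-rigid near
    near-good near (m ◅ r) = near-good (near-next near m) r

  -- Good terms are rigid, so `x` together with all good terms is a collapsed set.
  good-next : (∀ {a s} → term x ⟶[ a ] s → Goodˢ s) → Good x
  good-next {x} good = Collapsed.near-good collapsed (_ , inj₁ refl , ≃-refl)
    where
    D : State A → Set
    D s = s ≡ term x ⊎ Goodˢ s

    collapsed : Collapsed D
    collapsed = record
      { done = inj₂ tt
      ; expand = λ { (inj₁ refl) → expands-moves x (inj₂ ∘ good)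
                   ; (inj₂ g) → expands-moves _ (λ m → inj₂ (good-move m g)) }
      ; collapse = λ { _ (inj₂ g) e → g stay e
                     ; (inj₂ g) _ e → ≈-sym (g stay (≃-sym e))
                     ; (inj₁ refl) (inj₁ refl) _ → ≈-refl }
      }

  good-𝟘 : Good 𝟘
  good-𝟘 = good-next λ ()

  good-+ : Good x → Good y → Good (x + y)
  good-+ g g′ = good-next λ { (+-left m) → good-move m g ; (+-right m) → good-move m g′ }

-- Expressions all of whose states halt, up to exits.

module Expressions {A : Set} (_≟_ : DecidableEquality A) where

  open Uniqueness _≟_ public

  infixl 6 _⊕_ _⊞_
  infixr 7 _⊙_ _▷_
  infixr 8 _⊛_

  -- Terms all of whose states halt, except for those entered through the exits z of e ⊞ z.
  -- x ▷ e stands for x · e where e = u ⊛ v and x is a state of u: a pass through the loop that is under way.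
  data Exp : Set where
    act : A → Exp
    _⊕_ : Exp → Exp → Exp
    _⊞_ : Exp → Term A → Exp
    _⊙_ : Exp → Exp → Exp
    _⊛_ : Exp → Exp → Exp
    _▷_ : Exp → Exp → Exp

  ⟦_⟧ : Exp → Term A
  ⟦ act a ⟧ = act a
  ⟦ e ⊕ f ⟧ = ⟦ e ⟧ + ⟦ f ⟧
  ⟦ e ⊞ z ⟧ = ⟦ e ⟧ + z
  ⟦ e ⊙ f ⟧ = ⟦ e ⟧ · ⟦ f ⟧
  ⟦ e ⊛ f ⟧ = ⟦ e ⟧ * ⟦ f ⟧
  ⟦ x ▷ e ⟧ = ⟦ x ⟧ · ⟦ e ⟧

  private
    variable
      a : A
      e f u v x y : Exp
      k z p q : Term A
      P Q : Term A → Set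
      s : State A

  data _∈states_ : Exp → Exp → Set where
    ⊕ˡ : x ∈states e → x ∈states (e ⊕ f)
    ⊕ʳ : x ∈states f → x ∈states (e ⊕ f)
    ⊞ˡ : x ∈states e → x ∈states (e ⊞ z)
    ⊙ˡ : x ∈states e → (x ⊙ f) ∈states (e ⊙ f)
    ⊙ᵐ : f ∈states (e ⊙ f)
    ⊙ʳ : x ∈states f → x ∈states (e ⊙ f)
    ⊛ˡ : x ∈states e → (x ▷ e ⊛ f) ∈states (e ⊛ f)
    ⊛ᵐ : (e ⊛ f) ∈states (e ⊛ f)
    ⊛ʳ : x ∈states f → x ∈states (e ⊛ f)
    ▷ˡ : y ∈states x → (y ▷ e) ∈states (x ▷ e)
    ▷ʳ : y ∈states e → y ∈states (x ▷ e)

  -- Loop u v e: the expression e contains, outside the body of any other loop, a loop with body u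
  -- that is left through v, so that e · k has the state u * (v · k).
  data Loop (u : Exp) : Exp → Exp → Set where
    here : Loop u v (u ⊛ v)
    ⊕ˡ : Loop u v e → Loop u v (e ⊕ f)
    ⊕ʳ : Loop u v f → Loop u v (e ⊕ f)
    ⊞ˡ : Loop u v e → Loop u v (e ⊞ z)
    ⊙ˡ : Loop u v e → Loop u (v ⊙ f) (e ⊙ f)
    ⊙ʳ : Loop u v f → Loop u v (e ⊙ f)
    ⊛ʳ : Loop u v f → Loop u v (e ⊛ f)
    ▷ʳ : Loop u v e → Loop u v (x ▷ e)

  -- In `under-way` the left part is a state of the body `u`. Its loops, which `Loop` passes over,
  -- are therefore loops of `u`.
  data Wf (P : Term A → Set) : Exp → Set where
    act : Wf P (act a)
    _⊕_ : Wf P e → Wf P f → Wf P (e ⊕ f)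
    _⊞_ : Wf P e → P z → Wf P (e ⊞ z)
    _⊙_ : Wf P e → Wf P f → Wf P (e ⊙ f)
    _⊛_ : Wf P e → Wf P f → Wf P (e ⊛ f)
    under-way : x ∈states u → Wf P x → Wf P (u ⊛ v) → Wf P (x ▷ u ⊛ v)

  some-state? : ∀ e {Q : Exp → Set} → (∀ x → Dec (Q x)) → Dec (∃[ x ] (x ∈states e × Q x))
  some-state? (act a) Q? = no λ ()
  some-state? (e ⊕ f) Q? = map′
    [ (λ (_ , i , q) → _ , ⊕ˡ i , q) , (λ (_ , i , q) → _ , ⊕ʳ i , q) ]′
    (λ { (_ , ⊕ˡ i , q) → inj₁ (_ , i , q) ; (_ , ⊕ʳ i , q) → inj₂ (_ , i , q) })
    (some-state? e Q? ⊎-dec some-state? f Q?)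
  some-state? (e ⊞ z) Q? = map′
    (λ (_ , i , q) → _ , ⊞ˡ i , q) (λ { (_ , ⊞ˡ i , q) → _ , i , q }) (some-state? e Q?)
  some-state? (e ⊙ f) Q? = map′
    [ (λ (_ , i , q) → _ , ⊙ˡ i , q) , [ (λ q → _ , ⊙ᵐ , q) , (λ (_ , i , q) → _ , ⊙ʳ i , q) ]′ ]′
    (λ { (_ , ⊙ˡ i , q) → inj₁ (_ , i , q) ; (_ , ⊙ᵐ , q) → inj₂ (inj₁ q)
       ; (_ , ⊙ʳ i , q) → inj₂ (inj₂ (_ , i , q)) })
    (some-state? e (λ x → Q? (x ⊙ f)) ⊎-dec Q? f ⊎-dec some-state? f Q?)
  some-state? (e ⊛ f) Q? = map′
    [ (λ (_ , i , q) → _ , ⊛ˡ i , q) , [ (λ q → _ , ⊛ᵐ , q) , (λ (_ , i , q) → _ , ⊛ʳ i , q) ]′ ]′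
    (λ { (_ , ⊛ˡ i , q) → inj₁ (_ , i , q) ; (_ , ⊛ᵐ , q) → inj₂ (inj₁ q)
       ; (_ , ⊛ʳ i , q) → inj₂ (inj₂ (_ , i , q)) })
    (some-state? e (λ x → Q? (x ▷ e ⊛ f)) ⊎-dec Q? (e ⊛ f) ⊎-dec some-state? f Q?)
  some-state? (x ▷ e) Q? = map′
    [ (λ (_ , i , q) → _ , ▷ˡ i , q) , (λ (_ , i , q) → _ , ▷ʳ i , q) ]′
    (λ { (_ , ▷ˡ i , q) → inj₁ (_ , i , q) ; (_ , ▷ʳ i , q) → inj₂ (_ , i , q) })
    (some-state? x (λ y → Q? (y ▷ e)) ⊎-dec some-state? e Q?)

  some-loop? : ∀ e {Q : Exp → Exp → Set} → (∀ u v → Dec (Q u v)) →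
               Dec (∃[ u ] ∃[ v ] (Loop u v e × Q u v))
  some-loop? (act a) Q? = no λ ()
  some-loop? (e ⊕ f) Q? = map′
    [ (λ (_ , _ , l , q) → _ , _ , ⊕ˡ l , q) , (λ (_ , _ , l , q) → _ , _ , ⊕ʳ l , q) ]′
    (λ { (_ , _ , ⊕ˡ l , q) → inj₁ (_ , _ , l , q) ; (_ , _ , ⊕ʳ l , q) → inj₂ (_ , _ , l , q) })
    (some-loop? e Q? ⊎-dec some-loop? f Q?)
  some-loop? (e ⊞ z) Q? = map′
    (λ (_ , _ , l , q) → _ , _ , ⊞ˡ l , q) (λ { (_ , _ , ⊞ˡ l , q) → _ , _ , l , q }) (some-loop? e Q?)
  some-loop? (e ⊙ f) Q? = map′
    [ (λ (_ , _ , l , q) → _ , _ , ⊙ˡ l , q) , (λ (_ , _ , l , q) → _ , _ , ⊙ʳ l , q) ]′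
    (λ { (_ , _ , ⊙ˡ l , q) → inj₁ (_ , _ , l , q) ; (_ , _ , ⊙ʳ l , q) → inj₂ (_ , _ , l , q) })
    (some-loop? e (λ u v → Q? u (v ⊙ f)) ⊎-dec some-loop? f Q?)
  some-loop? (e ⊛ f) Q? = map′
    [ (λ q → _ , _ , here , q) , (λ (_ , _ , l , q) → _ , _ , ⊛ʳ l , q) ]′
    (λ { (_ , _ , here , q) → inj₁ q ; (_ , _ , ⊛ʳ l , q) → inj₂ (_ , _ , l , q) })
    (Q? e f ⊎-dec some-loop? f Q?)
  some-loop? (x ▷ e) Q? = map′
    (λ (_ , _ , l , q) → _ , _ , ▷ʳ l , q) (λ { (_ , _ , ▷ʳ l , q) → _ , _ , l , q }) (some-loop? e Q?)

  states-trans : x ∈states u → y ∈states x → y ∈states u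
  states-trans (⊕ˡ i) j = ⊕ˡ (states-trans i j)
  states-trans (⊕ʳ i) j = ⊕ʳ (states-trans i j)
  states-trans (⊞ˡ i) j = ⊞ˡ (states-trans i j)
  states-trans (⊙ˡ i) (⊙ˡ j) = ⊙ˡ (states-trans i j)
  states-trans (⊙ˡ i) ⊙ᵐ = ⊙ᵐ
  states-trans (⊙ˡ i) (⊙ʳ j) = ⊙ʳ j
  states-trans ⊙ᵐ j = ⊙ʳ j
  states-trans (⊙ʳ i) j = ⊙ʳ (states-trans i j)
  states-trans (⊛ˡ i) (▷ˡ j) = ⊛ˡ (states-trans i j)
  states-trans (⊛ˡ i) (▷ʳ j) = j
  states-trans ⊛ᵐ j = j
  states-trans (⊛ʳ i) j = ⊛ʳ (states-trans i j)
  states-trans (▷ˡ i) (▷ˡ j) = ▷ˡ (states-trans i j)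
  states-trans (▷ˡ i) (▷ʳ j) = ▷ʳ j
  states-trans (▷ʳ i) j = ▷ʳ (states-trans i j)

  wf-state : Wf P u → x ∈states u → Wf P x
  wf-state (w ⊕ w′) (⊕ˡ i) = wf-state w i
  wf-state (w ⊕ w′) (⊕ʳ i) = wf-state w′ i
  wf-state (w ⊞ _) (⊞ˡ i) = wf-state w i
  wf-state (w ⊙ w′) (⊙ˡ i) = wf-state w i ⊙ w′
  wf-state (w ⊙ w′) ⊙ᵐ = w′
  wf-state (w ⊙ w′) (⊙ʳ i) = wf-state w′ i
  wf-state (w ⊛ w′) (⊛ˡ i) = under-way i (wf-state w i) (w ⊛ w′)
  wf-state (w ⊛ w′) ⊛ᵐ = w ⊛ w′
  wf-state (w ⊛ w′) (⊛ʳ i) = wf-state w′ i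
  wf-state (under-way i w w′) (▷ˡ j) = under-way (states-trans i j) (wf-state w j) w′
  wf-state (under-way i w w′) (▷ʳ j) = wf-state w′ j

  wf-loop : Wf P e → Loop u v e → Wf P u × Wf P v
  wf-loop (w ⊛ w′) here = w , w′
  wf-loop (w ⊕ w′) (⊕ˡ l) = wf-loop w l
  wf-loop (w ⊕ w′) (⊕ʳ l) = wf-loop w′ l
  wf-loop (w ⊞ _) (⊞ˡ l) = wf-loop w l
  wf-loop (w ⊙ w′) (⊙ˡ l) = let wu , wv = wf-loop w l in wu , wv ⊙ w′
  wf-loop (w ⊙ w′) (⊙ʳ l) = wf-loop w′ l
  wf-loop (w ⊛ w′) (⊛ʳ l) = wf-loop w′ l
  wf-loop (under-way _ _ w) (▷ʳ l) = wf-loop w l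

  -- Depends on `▷`: a pass under way through a loop contributes no loops from its left part. With
  -- `⊙` in its place, a loop inside the body would become an outermost loop of a state.
  loop-state : x ∈states e → Loop u v x → Loop u v e
  loop-state (⊕ˡ i) l = ⊕ˡ (loop-state i l)
  loop-state (⊕ʳ i) l = ⊕ʳ (loop-state i l)
  loop-state (⊞ˡ i) l = ⊞ˡ (loop-state i l)
  loop-state (⊙ˡ i) (⊙ˡ l) = ⊙ˡ (loop-state i l)
  loop-state (⊙ˡ i) (⊙ʳ l) = ⊙ʳ l
  loop-state ⊙ᵐ l = ⊙ʳ l
  loop-state (⊙ʳ i) l = ⊙ʳ (loop-state i l)
  loop-state (⊛ˡ i) (▷ʳ l) = l
  loop-state ⊛ᵐ l = l
  loop-state (⊛ʳ i) l = ⊛ʳ (loop-state i l)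
  loop-state (▷ˡ i) (▷ʳ l) = ▷ʳ l
  loop-state (▷ʳ i) l = ▷ʳ (loop-state i l)

  -- Identifies the states inside a loop with states of the whole expression, so that what is known
  -- about the latter can be used for the body.
  body-state : Loop u v e → x ∈states u →
               ∃[ y ] (y ∈states e × (∀ {k} → ⟦ y ⟧ · k ≈ ⟦ x ⟧ · (⟦ u ⟧ * (⟦ v ⟧ · k))))
  body-state here i = _ , ⊛ˡ i , ≈-trans (B5 _ _ _) (·-cong ≈-refl (BKS2 _ _ _))
  body-state (⊕ˡ l) i = let _ , j , d = body-state l i in _ , ⊕ˡ j , d
  body-state (⊕ʳ l) i = let _ , j , d = body-state l i in _ , ⊕ʳ j , d
  body-state (⊞ˡ l) i = let _ , j , d = body-state l i in _ , ⊞ˡ j , d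
  body-state (⊙ˡ l) i = let _ , j , d = body-state l i in _ , ⊙ˡ j ,
    ≈-trans (B5 _ _ _) (≈-trans d (·-cong ≈-refl (*-cong ≈-refl (≈-sym (B5 _ _ _)))))
  body-state (⊙ʳ l) i = let _ , j , d = body-state l i in _ , ⊙ʳ j , d
  body-state (⊛ʳ l) i = let _ , j , d = body-state l i in _ , ⊛ʳ j , d
  body-state (▷ʳ l) i = let _ , j , d = body-state l i in _ , ▷ʳ j , d

  -- The part x of x ▷ e does not count: it only repeats loops in the body of e.
  stars : Exp → ℕ
  stars (act a) = 0
  stars (e ⊕ f) = stars e ℕ.+ stars f
  stars (e ⊞ z) = stars e
  stars (e ⊙ f) = stars e ℕ.+ stars f
  stars (e ⊛ f) = suc (stars e ℕ.+ stars f)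
  stars (x ▷ e) = stars e

  stars-state : x ∈states e → stars x ≤ stars e
  stars-state (⊕ˡ i) = ℕ.m≤n⇒m≤n+o _ (stars-state i)
  stars-state (⊕ʳ {e = e} i) = ℕ.m≤n⇒m≤o+n (stars e) (stars-state i)
  stars-state (⊞ˡ i) = stars-state i
  stars-state (⊙ˡ i) = ℕ.+-monoˡ-≤ _ (stars-state i)
  stars-state (⊙ᵐ {e = e}) = ℕ.m≤n+m _ (stars e)
  stars-state (⊙ʳ {e = e} i) = ℕ.m≤n⇒m≤o+n (stars e) (stars-state i)
  stars-state (⊛ˡ i) = ℕ.≤-refl
  stars-state ⊛ᵐ = ℕ.≤-refl
  stars-state (⊛ʳ {e = e} i) = ℕ.m≤n⇒m≤1+n (ℕ.m≤n⇒m≤o+n (stars e) (stars-state i))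
  stars-state (▷ˡ i) = ℕ.≤-refl
  stars-state (▷ʳ i) = stars-state i

  stars-loop : Loop u v e → stars u ℕ.+ stars v < stars e
  stars-loop here = ℕ.n<1+n _
  stars-loop (⊕ˡ l) = ℕ.m≤n⇒m≤n+o _ (stars-loop l)
  stars-loop (⊕ʳ {e = e} l) = ℕ.m≤n⇒m≤o+n (stars e) (stars-loop l)
  stars-loop (⊞ˡ l) = stars-loop l
  stars-loop {u} (⊙ˡ {v} {e} {f} l) =
    subst (_< stars e ℕ.+ stars f) (ℕ.+-assoc (stars u) (stars v) (stars f)) (ℕ.+-monoˡ-< (stars f) (stars-loop l))
  stars-loop (⊙ʳ {e = e} l) = ℕ.m≤n⇒m≤o+n (stars e) (stars-loop l)
  stars-loop (⊛ʳ {e = e} l) = ℕ.m≤n⇒m≤1+n (ℕ.m≤n⇒m≤o+n (stars e) (stars-loop l))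
  stars-loop (▷ʳ l) = stars-loop l

  -- Arbitrary terms enter only as summands next to an expression, which supplies the halting run.
  halts : Halts ⟦ e ⟧
  halts {act a} = act
  halts {e ⊕ f} = +ˡ halts
  halts {e ⊞ z} = +ˡ halts
  halts {e ⊙ f} = halts · halts
  halts {e ⊛ f} = *ʳ halts
  halts {x ▷ e} = halts · halts

  -- The semantic counterpart of being unable to halt: in contrast to the syntactic condition, it is
  -- stated by bisimilarity and so passes to successors and to bisimilar terms.
  Mute : Term A → Set
  Mute z = z · 𝟘 ∼ z

  mute-· : Mute z → z · k ∼ z
  mute-· m = ≃-trans (∼-·-cong (≃-sym m) ≃-refl)
    (≃-trans (sound (≈-trans (B5 _ _ _) (·-cong ≈-refl (B7 _)))) m)

  mute-√ : Mute z → ¬ term z ⟶[ a ] √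
  mute-√ m t with forth (≃-sym m) t
  ... | _ , t′ , d with move _ ← ·-inv t′ = not-√ (≃-sym d)

  mute-next : Mute z → term z ⟶[ a ] term p → Mute p
  mute-next m t with forth (≃-sym m) t
  ... | _ , t′ , d with move {s = s} _ ← ·-inv t′ =
    ≃-trans (∼-·-cong d ≃-refl) (≃-trans (absorbs s) (≃-sym d))
    where
    absorbs : ∀ s → (s ▸ 𝟘) · 𝟘 ∼ s ▸ 𝟘
    absorbs √ = sound (B7 _)
    absorbs (term x) = sound (≈-trans (B5 _ _ _) (·-cong ≈-refl (B7 _)))

  GoodMute : Term A → Set
  GoodMute z = Good z × Mute z

  Avoids : Term A → Term A → Set
  Avoids root z = ∀ {y} → Reach z y → ¬ y ∼ root

  -- Existence: collapsing the body of a loop at the root.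

  module Construction (root : Term A) where

    -- `good` lets the states of an exit join the collapsed set as they are, `silent` lets them
    -- ignore whatever follows, and `avoids` keeps them off every route to the root.
    record Exit (z : Term A) : Set where
      field
        good   : Good z
        silent : Mute z
        avoids : Avoids root z

    open Exit

    exit-∼ : z ∼ p → Exit z → Exit p
    exit-∼ e x = record
      { good = good-∼ e (good x)
      ; silent = ≃-trans (∼-·-cong (≃-sym e) ≃-refl) (≃-trans (silent x) e)
      ; avoids = λ r d → let _ , r′ , c = reach-∼ (≃-sym e) r in avoids x r′ (≃-trans (≃-sym c) d)
      }

    exit-next : Exit z → term z ⟶[ a ] term p → Exit p
    exit-next x m = record
      { good = good-move m (good x)
      ; silent = mute-next (silent x) m
      ; avoids = λ r → avoids x (m ◅ r)
      }

    exit-· : Exit z → Exit (z · k)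
    exit-· x = exit-∼ (≃-sym (mute-· (silent x))) x

    data Step (e : Exp) : State A → Set where
      stop : Step e √
      move : x ∈states e → Step e (term ⟦ x ⟧)
      exit : Exit z → Step e (term z)

    step-map : (∀ {x} → x ∈states e → x ∈states f) → Step e s → Step f s
    step-map g stop = stop
    step-map g (move i) = move (g i)
    step-map g (exit x) = exit x

    step-view : Wf Exit e → term ⟦ e ⟧ ⟶[ a ] s → Step e s
    step-view act act-done = stop
    step-view (w ⊕ w′) (+-left m) = step-map ⊕ˡ (step-view w m)
    step-view (w ⊕ w′) (+-right m) = step-map ⊕ʳ (step-view w′ m)
    step-view (w ⊞ x) (+-left m) = step-map ⊞ˡ (step-view w m)
    step-view {s = √} (w ⊞ x) (+-right m) = contradiction m (mute-√ (silent x))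
    step-view {s = term _} (w ⊞ x) (+-right m) = exit (exit-next x m)
    step-view (w ⊙ w′) (·-done m) = move ⊙ᵐ
    step-view (w ⊙ w′) (·-step m) with step-view w m
    ... | move i = move (⊙ˡ i)
    ... | exit x = exit (exit-· x)
    step-view (w ⊛ w′) (*-loop m) = move ⊛ᵐ
    step-view (w ⊛ w′) (*-exit m) = step-map ⊛ʳ (step-view w′ m)
    step-view (w ⊛ w′) (*-step m) with step-view w m
    ... | move i = move (⊛ˡ i)
    ... | exit x = exit (exit-· x)
    step-view (under-way _ w w′) (·-done m) = move (▷ʳ ⊛ᵐ)
    step-view (under-way _ w w′) (·-step m) with step-view w m
    ... | move i = move (▷ˡ i)
    ... | exit x = exit (exit-· x)

    private
      variable
        B C : List (Term A)
        O V W : Term A → Set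
        κ t r : Term A

    -- Relative to a continuation κ, the elements t of B are names of the terms t · κ, and √ is a name of κ.
    data Name (B : List (Term A)) : State A → Set where
      self : Name B √
      pool : t ∈ B → Name B (term t)

    data Target (B : List (Term A)) : State A → Set where
      name : Name B s → Target B s
      exit : Exit z → Target B (term z)

    -- O stands for the terms seen before the loop at κ was entered.
    data Seen (O : Term A → Set) (κ : Term A) (B : List (Term A)) : Term A → Set where
      named : Name B s → Seen O κ B (s ▸ κ)
      outer : O p → Seen O κ B p

    data Route (V : Term A → Set) : Term A → Set where
      here : p ∼ root → Route V p
      step : ∀ {p′ q} → term p ⟶[ a ] term p′ → p′ ∼ q → V q → Route V q → Route V p

    -- Says by absorption that `U` has a prefix leading to a name. Hence `U · κ` moves to a named
    -- term, which is the first step of a route.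
    Live : List (Term A) → Term A → Set
    Live B U = ∃[ a ] ∃[ s ] (Name B s × U + pre a s ≈ U)

    -- The routes are what makes the states of an inner loop differ from everything seen before it, see stays.
    record Pool (O : Term A → Set) (κ : Term A) (B : List (Term A)) : Set where
      field
        expand   : t ∈ B → Expands (Target B) t
        distinct : ∀ {t t′} → t ∈ B → t′ ∈ B → t · κ ∼ t′ · κ → t ≡ t′
        off      : t ∈ B → ¬ t · κ ∼ κ
        fresh    : t ∈ B → O p → ¬ t · κ ∼ p
        route    : Seen O κ B p → Route (Seen O κ B) p
        anchor   : Seen O κ B root

    open Pool

    _⊆_ : List (Term A) → List (Term A) → Set
    B ⊆ C = ∀ {t} → t ∈ B → t ∈ C

    name-mono : B ⊆ C → Name B s → Name C s
    name-mono i self = self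
    name-mono i (pool j) = pool (i j)

    target-mono : B ⊆ C → Target B s → Target C s
    target-mono i (name n) = name (name-mono i n)
    target-mono i (exit x) = exit x

    seen-mono : B ⊆ C → Seen O κ B p → Seen O κ C p
    seen-mono i (named n) = named (name-mono i n)
    seen-mono i (outer o) = outer o

    route-∼ : p ∼ q → Route V p → Route V q
    route-∼ e (here d) = here (≃-trans (≃-sym e) d)
    route-∼ e (step m d v r) =
      let _ , m′ , c = forth-term e m in step m′ (≃-trans (≃-sym c) d) v r

    route-map : (∀ {p} → V p → ∃[ q ] (W q × p ∼ q)) → Route V p → Route W p
    route-map f (here d) = here d
    route-map f (step m d v r) =
      let _ , w , c = f v in step m (≃-trans d c) w (route-∼ c (route-map f r))

    -- A route ends at the root, and no exit reaches the root.
    exit-no-route : Exit z → z ∼ p → ¬ Route V p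
    exit-no-route x e (here d) = avoids x stay (≃-trans e d)
    exit-no-route x e (step m d v r) =
      let _ , m′ , c = forth-term (≃-sym e) m
      in exit-no-route (exit-next x m′) (≃-trans (≃-sym c) d) r

    live-+ : Live B q → Live B (p + q)
    live-+ (a , s , n , e) = a , s , n , ≈-trans (B2 _ _ _) (+-cong ≈-refl e)

    live-≈ : p ≈ q → Live B p → Live B q
    live-≈ d (a , s , n , e) = a , s , n , ≈-trans (+-cong (≈-sym d) ≈-refl) (≈-trans e d)

    live-mono : B ⊆ C → Live B p → Live C p
    live-mono i (a , s , n , e) = a , s , name-mono i n , e

    live-move : Live B r → r · κ ∼ p →
                ∃[ a ] ∃[ s ] ∃[ q ] (Name B s × term p ⟶[ a ] term q × q ∼ s ▸ κ)
    live-move {r = r} {κ = κ} (a , s , n , e) d =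
      let _ , m , c = forth-term (≃-trans (sound (·-cong e ≈-refl)) d)
                                 (·-move {q = κ} (+-right {p = r} (pre-move {a = a} {s = s})))
      in a , s , _ , n , m , ≃-sym c

    live-route : Pool O κ B → Live B r → r · κ ∼ p → Route (Seen O κ B) p
    live-route P l d = let _ , _ , _ , n , m , c = live-move l d in step m c (named n) (route P (named n))

    named? : ∀ κ B k → Dec (∃[ s ] (Name B s × s ▸ κ ∼ k))
    named? κ B k = map′
      [ (λ e → √ , self , e) , (λ x → let _ , i , e = find x in _ , pool i , e) ]′
      (λ { (√ , self , e) → inj₁ e ; (term _ , pool i , e) → inj₂ (lose i e) })
      (κ ∼? k ⊎-dec Any.any? (λ t → (t · κ) ∼? k) B)

    record Naming (O : Term A → Set) (κ : Term A) (B : List (Term A)) (k : Term A) : Set where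
      field
        {B′}   : List (Term A)
        {s′}   : State A
        subset : B ⊆ B′
        isPool : Pool O κ B′
        isName : Name B′ s′
        value  : s′ ▸ κ ∼ k

    -- An existing name for `k` is reused. Otherwise the absence of a name gives `distinct` and
    -- `off` for the new one, the last hypothesis gives `fresh`, and `Live` gives its route.
    insert : Pool O κ B → r · κ ∼ k → Expands (Target B) r → Live B r →
             (∀ {p} → O p → ¬ k ∼ p) → Naming O κ B k
    insert {O} {κ} {B} {r} {k} P d exp live new with named? κ B k
    ... | yes (_ , n , e) = record { subset = id ; isPool = P ; isName = n ; value = e }
    ... | no ¬n = record { subset = there ; isPool = P′ ; isName = pool (here refl) ; value = d }
      where
      P′ : Pool O κ (r ∷ B)
      P′ .expand (here refl) = expands-mono (target-mono there) exp
      P′ .expand (there i) = expands-mono (target-mono there) (expand P i)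
      P′ .distinct (here refl) (here refl) e = refl
      P′ .distinct (here refl) (there j) e = contradiction (_ , pool j , ≃-trans (≃-sym e) d) ¬n
      P′ .distinct (there i) (here refl) e = contradiction (_ , pool i , ≃-trans e d) ¬n
      P′ .distinct (there i) (there j) e = distinct P i j e
      P′ .off (here refl) e = ¬n (_ , self , ≃-trans (≃-sym e) d)
      P′ .off (there i) = off P i
      P′ .fresh (here refl) o e = new o (≃-trans (≃-sym d) e)
      P′ .fresh (there i) = fresh P i
      P′ .route v = route-map (λ v → _ , seen-mono there v , ≃-refl) (old v)
        where
        old : Seen O κ (r ∷ B) p → Route (Seen O κ B) p
        old (named self) = route P (named self)
        old (named (pool (here refl))) = live-route P live ≃-refl
        old (named (pool (there i))) = route P (named (pool i))
        old (outer o) = route P (outer o)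
      P′ .anchor = seen-mono there (anchor P)

    -- `U` replaces the traversed term. It need not have a name, so that the results for two
    -- summands can simply be added.
    record Result (O : Term A → Set) (κ : Term A) (B : List (Term A)) (k : Term A) : Set where
      field
        {B′}    : List (Term A)
        subset  : B ⊆ B′
        isPool  : Pool O κ B′
        {U}     : Term A
        value   : U · κ ∼ k
        expands : Expands (Target B′) U
        live    : Live B′ U

    result-∼ : k ∼ p → Result O κ B k → Result O κ B p
    result-∼ e r = record { Result r ; value = ≃-trans (Result.value r) e }

    -- Terms seen before the loop at `κ` was entered have no names relative to `κ`, so the traversal
    -- must not arrive at one.
    Fresh : (Term A → Set) → Term A → Exp → Set
    Fresh O k e = ∀ {x p} → x ∈states e → O p → ¬ ⟦ x ⟧ · k ∼ p

    -- Excludes the case that breaks the shape of a term, a copy of the root inside the body of an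
    -- inner loop; `good-*` deals with that case.
    Proper : Term A → Exp → Set
    Proper k e = ∀ {u v x} → Loop u v e → x ∈states u → ¬ ⟦ x ⟧ · (⟦ u ⟧ * (⟦ v ⟧ · k)) ∼ root

    -- The continuation `k` of the original term and its representative `s ▸ κ` are kept apart: the
    -- conditions on states speak of `k`, while the result is built from `s`.
    Collapsible : Exp → Set₁
    Collapsible e = ∀ {O κ B s k} → Pool O κ B → Name B s → s ▸ κ ∼ k →
                    Fresh O k e → Proper k e → Result O κ B (⟦ e ⟧ · k)

    collapse-act : Collapsible (act a)
    collapse-act {a} {s = s} P n e _ _ = record
      { subset = id
      ; isPool = P
      ; U = pre a s
      ; value = ≃-trans (sound (pre-▸ s)) (∼-·-cong ≃-refl e)
      ; expands = (a , s) ∷ [] , ≈-sym (B6 _) , name n ∷ []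
      ; live = a , s , n , B3 _
      }

    collapse-⊕ : Collapsible e → Collapsible f → Collapsible (e ⊕ f)
    collapse-⊕ ce cf P n e fr pr = record
      { subset = F.subset ∘ E.subset
      ; isPool = F.isPool
      ; value = ≃-trans (sound (B4 _ _ _)) (≃-trans (∼-+-cong E.value F.value) (sound (≈-sym (B4 _ _ _))))
      ; expands = expands-+ (expands-mono (target-mono F.subset) E.expands) F.expands
      ; live = live-+ F.live
      }
      where
      module E = Result (ce P n e (fr ∘ ⊕ˡ) (pr ∘ ⊕ˡ))
      module F = Result (cf E.isPool (name-mono E.subset n) e (fr ∘ ⊕ʳ) (pr ∘ ⊕ʳ))

    collapse-⊞ : Collapsible e → Exit z → Collapsible (e ⊞ z)
    collapse-⊞ {z = z} ce x P n e fr pr = record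
      { subset = E.subset
      ; isPool = E.isPool
      ; U = z + E.U
      ; value = ≃-trans (sound (≈-trans (B4 _ _ _) (B1 _ _)))
          (≃-trans (∼-+-cong E.value (≃-trans (mute-· (silent x)) (≃-sym (mute-· (silent x)))))
                   (sound (≈-sym (B4 _ _ _))))
      ; expands = expands-+ (expands-moves z moves-to) E.expands
      ; live = live-+ E.live
      }
      where
      module E = Result (ce P n e (fr ∘ ⊞ˡ) (pr ∘ ⊞ˡ))
      moves-to : term z ⟶[ a ] s → Target B s
      moves-to {s = √} m = contradiction m (mute-√ (silent x))
      moves-to {s = term _} m = exit (exit-next x m)

    -- The second factor is traversed first, because the name of its start is the continuation for
    -- the first factor.
    collapse-then : Collapsible e → Collapsible f → ∀ {O κ B s k} → Pool O κ B → Name B s → s ▸ κ ∼ k →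
      Fresh O k f → Proper k f → (∀ {p} → O p → ¬ ⟦ f ⟧ · k ∼ p) →
      Fresh O (⟦ f ⟧ · k) e → Proper (⟦ f ⟧ · k) e → Result O κ B (⟦ e ⟧ · (⟦ f ⟧ · k))
    collapse-then ce cf P n e fr pr new fr′ pr′ =
      record { Result E ; subset = Result.subset E ∘ N.subset ∘ F.subset }
      where
      module F = Result (cf P n e fr pr)
      module N = Naming (insert F.isPool F.value F.expands F.live new)
      E = ce N.isPool N.isName N.value fr′ pr′

    collapse-⊙ : Collapsible e → Collapsible f → Collapsible (e ⊙ f)
    collapse-⊙ ce cf P n e fr pr = result-∼ (sound (≈-sym (B5 _ _ _)))
      (collapse-then ce cf P n e (fr ∘ ⊙ʳ) (pr ∘ ⊙ʳ) (fr ⊙ᵐ)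
        (λ i o d → fr (⊙ˡ i) o (≃-trans (sound (B5 _ _ _)) d))
        (λ l i d → pr (⊙ˡ l) i (≃-trans (sound (·-cong ≈-refl (*-cong ≈-refl (B5 _ _ _)))) d)))

    proper-body : Loop u v e → Proper k e → Proper (⟦ u ⟧ * (⟦ v ⟧ · k)) u
    proper-body l pr l′ i d =
      let _ , j , c = body-state l′ i in pr l j (≃-trans (sound c) d)

    -- The loops of `x` are not loops of `x ▷ u ⊛ v`. They are loops of `u`, and the states in their
    -- bodies are states in the body of the loop `u ⊛ v`, for which properness is known.
    collapse-▷ : x ∈states u → Collapsible x → Collapsible (u ⊛ v) → Collapsible (x ▷ u ⊛ v)
    collapse-▷ i cx cuv P n e fr pr = result-∼ (sound (≈-sym (B5 _ _ _)))
      (collapse-then cx cuv P n e (fr ∘ ▷ʳ) (pr ∘ ▷ʳ) (fr (▷ʳ ⊛ᵐ))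
        (λ j o d → fr (▷ˡ j) o (≃-trans (sound (B5 _ _ _)) d))
        (λ l j d → proper-body (▷ʳ here) pr (loop-state i l) j
          (≃-trans (sound (·-cong ≈-refl (*-cong ≈-refl (·-cong ≈-refl (≈-sym (BKS2 _ _ _)))))) d)))

    -- The exit `v` is traversed first. If the head of the loop then has a name already, the star
    -- disappears: the body is traversed in the same pool and returns to that name. Otherwise the
    -- body gets an empty pool of its own, with the head as continuation and everything seen so far
    -- as outer terms, and a star is rebuilt from the two results.
    collapse-⊛ : Wf Exit u → Collapsible u → Collapsible v → Collapsible (u ⊛ v)
    collapse-⊛ {u} {v} w cu cv {O = O} {κ = κ} {k = k} P n e fr pr with cv P n e (fr ∘ ⊛ʳ) (pr ∘ ⊛ʳ)
    ... | rv with named? κ (Result.B′ rv) (⟦ u ⟧ * (⟦ v ⟧ · k))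
    ... | yes (s′ , n′ , e′) = record
      { subset = R.subset ∘ L.subset
      ; isPool = R.isPool
      ; U = R.U + L.U
      ; value = ≃-trans (sound (B4 _ _ _)) (≃-trans (∼-+-cong R.value L.value)
          (sound (≈-trans (BKS1 _ _) (≈-sym (BKS2 _ _ _)))))
      ; expands = expands-+ R.expands (expands-mono (target-mono R.subset) L.expands)
      ; live = live-+ (live-mono R.subset L.live)
      }
      where
      module L = Result rv
      fresh-body : Fresh O (⟦ u ⟧ * (⟦ v ⟧ · k)) u
      fresh-body i o d = let _ , j , c = body-state here i in fr j o (≃-trans (sound c) d)

      module R = Result (cu L.isPool n′ e′ fresh-body (proper-body here pr))
    ... | no ¬n = record
      { subset = old ∘ L.subset
      ; isPool = P′
      ; U = X
      ; value = ≃-trans value-X (sound (≈-sym (BKS2 _ _ _)))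
      ; expands = expands-X
      ; live = live-≈ (BKS1 _ _) (live-+ (live-mono old L.live))
      }
      where
      module L = Result rv
      loop = ⟦ u ⟧ * (⟦ v ⟧ · k)

      O′ : Term A → Set
      O′ = Seen O κ L.B′

      new : O′ p → ¬ loop ∼ p
      new (named n) d = ¬n (_ , n , ≃-sym d)
      new (outer o) d = fr ⊛ᵐ o (≃-trans (sound (BKS2 _ _ _)) d)

      -- A state of the body that is bisimilar to a seen term can follow the route of that term to the root,
      -- without passing through the head of the loop, which is not seen.
      stays : x ∈states u → ⟦ x ⟧ · loop ∼ p → ¬ Route O′ p
      stays i d (here c) = pr here i (≃-trans d c)
      stays i d (step m c o r) with forth-term (≃-sym d) m
      ... | _ , m′ , c′ with ·-inv m′
      ... | move mx with step-view (wf-state w i) mx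
      ... | stop = new o (≃-trans (≃-sym c′) c)
      ... | move j = stays (states-trans i j) (≃-trans (≃-sym c′) c) r
      ... | exit x = exit-no-route (exit-· x) (≃-trans (≃-sym c′) c) r

      start : Pool O′ loop []
      start .expand ()
      start .distinct ()
      start .off ()
      start .fresh ()
      -- The head of the loop can be left through `v`, whose result is live, so one step leads to a
      -- named term with a route.
      start .route (named self) =
        let _ , _ , _ , n , m , c = live-move L.live L.value
        in step (*-exit m) c (outer (named n)) (route-map (λ o → _ , outer o , ≃-refl) (route L.isPool (named n)))
      start .route (outer o) = route-map (λ o → _ , outer o , ≃-refl) (route L.isPool o)
      start .anchor = outer (anchor L.isPool)

      fresh-body : Fresh O′ loop u
      fresh-body i o d = stays i d (route L.isPool o)

      -- States in the body of an inner loop are states of `u`, which are fresh, whereas the root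
      -- has been seen.
      proper-inner : Proper loop u
      proper-inner l i d = let _ , j , c = body-state l i in fresh-body j (anchor L.isPool) (≃-trans (sound c) d)

      module R = Result (cu start self ≃-refl fresh-body proper-inner)

      X = R.U * L.U
      -- Names relative to the head of the loop become names relative to `κ` when followed by `X`,
      -- the new name of the head.
      D = map (_· X) R.B′ ++ X ∷ L.B′

      old : L.B′ ⊆ D
      old i = ∈-++⁺ʳ (map (_· X) R.B′) (there i)

      name-X : Name R.B′ s → Name D (term (s ▸ X))
      name-X self = pool (∈-++⁺ʳ (map (_· X) R.B′) (here refl))
      name-X (pool i) = pool (∈-++⁺ˡ (∈-map⁺ (_· X) i))

      target-X : Target R.B′ s → Target D (term (s ▸ X))
      target-X (name n) = name (name-X n)
      target-X (exit x) = exit (exit-· x)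

      value-X : X · κ ∼ loop
      value-X = ≃-trans (sound (BKS2 _ _ _)) (≃-sym (*-unique
        (≃-trans (sound (≈-sym (BKS1 _ _))) (∼-+-cong (≃-sym R.value) (≃-sym L.value)))))

      value-▸ : ∀ s → (s ▸ X) · κ ∼ s ▸ loop
      value-▸ √ = value-X
      value-▸ (term t) = ≃-trans (sound (B5 _ _ _)) (∼-·-cong ≃-refl value-X)

      expands-X : Expands (Target D) X
      expands-X = expands-≈ (BKS1 _ _)
        (expands-+ (expands-▸ target-X R.expands) (expands-mono (target-mono old) L.expands))

      data View : Term A → Set where
        inner : Name R.B′ s → View (s ▸ X)
        outer : t ∈ L.B′ → View t

      view : t ∈ D → View t
      view i with ∈-++⁻ (map (_· X) R.B′) i
      ... | inj₁ j with _ , j′ , refl ← ∈-map⁻ (_· X) j = inner (pool j′)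
      view i | inj₂ (here refl) = inner self
      view i | inj₂ (there j) = outer j

      fresh-inner : Name R.B′ s → O′ p → ¬ (s ▸ X) · κ ∼ p
      fresh-inner self o d = new o (≃-trans (≃-sym value-X) d)
      fresh-inner (pool i) o d = fresh R.isPool i o (≃-trans (≃-sym (value-▸ _)) d)

      distinct-inner : ∀ {s s′} → Name R.B′ s → Name R.B′ s′ → s ▸ loop ∼ s′ ▸ loop → s ≡ s′
      distinct-inner self self d = refl
      distinct-inner self (pool i) d = contradiction (≃-sym d) (off R.isPool i)
      distinct-inner (pool i) self d = contradiction d (off R.isPool i)
      distinct-inner (pool i) (pool j) d = cong term (distinct R.isPool i j d)

      P′ : Pool O κ D
      P′ .expand i with view i
      ... | inner self = expands-X
      ... | inner (pool j) = expands-▸ target-X (expand R.isPool j)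
      ... | outer j = expands-mono (target-mono old) (expand L.isPool j)
      P′ .distinct i j d with view i | view j
      ... | inner n | inner n′ = cong (_▸ X) (distinct-inner n n′
        (≃-trans (≃-sym (value-▸ _)) (≃-trans d (value-▸ _))))
      ... | inner n | outer j′ = contradiction d (fresh-inner n (named (pool j′)))
      ... | outer i′ | inner n = contradiction (≃-sym d) (fresh-inner n (named (pool i′)))
      ... | outer i′ | outer j′ = distinct L.isPool i′ j′ d
      P′ .off i d with view i
      ... | inner n = fresh-inner n (named self) d
      ... | outer i′ = off L.isPool i′ d
      P′ .fresh i o d with view i
      ... | inner n = fresh-inner n (outer o) d
      ... | outer i′ = fresh L.isPool i′ o d
      -- The inner pool and `D` have the same seen terms up to bisimilarity, so the routes of the
      -- former carry over.
      P′ .route {p} v = let _ , v′ , d = backward v in route-∼ (≃-sym d) (route-map forward (route R.isPool v′))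
        where
        forward : ∀ {p} → Seen O′ loop R.B′ p → ∃[ q ] (Seen O κ D q × p ∼ q)
        forward (named n) with pool i ← name-X n = _ , named (pool i) , ≃-sym (value-▸ _)
        forward (outer o) = _ , seen-mono old o , ≃-refl
        backward : ∀ {p} → Seen O κ D p → ∃[ q ] (Seen O′ loop R.B′ q × p ∼ q)
        backward (outer o) = _ , outer (outer o) , ≃-refl
        backward (named self) = _ , outer (named self) , ≃-refl
        backward (named (pool i)) with view i
        ... | inner n = _ , named n , value-▸ _
        ... | outer i′ = _ , outer (named (pool i′)) , ≃-refl
      P′ .anchor = seen-mono old (anchor L.isPool)

    collapse : Wf Exit e → Collapsible e
    collapse act = collapse-act
    collapse (w ⊕ w′) = collapse-⊕ (collapse w) (collapse w′)
    collapse (w ⊞ x) = collapse-⊞ (collapse w) x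
    collapse (w ⊙ w′) = collapse-⊙ (collapse w) (collapse w′)
    collapse (w ⊛ w′) = collapse-⊛ w (collapse w) (collapse w′)
    collapse (under-way i w w′) = collapse-▷ i (collapse w) (collapse w′)

-- All terms are good.

module Completeness {A : Set} (_≟_ : DecidableEquality A) where

  open Expressions _≟_ public

  private
    variable
      e : Exp
      p q r : Term A
      a : A
      s : State A

  module _ (root : Term A) where

    open Construction root

    -- The body is collapsed with the root as continuation and nothing seen before. The collapsed
    -- set consists of `√`, the rebuilt loop `X`, the names followed by `X`, and all good terms. The
    -- conditions `distinct` and `off` separate the members built from `X`, and good terms are
    -- rigid.
    good-root : Wf Exit e → Good r → root ≡ ⟦ e ⟧ * r → Proper root e → Good root
    good-root {e} {r} w g refl pr = Collapsed.near-good collapsed (_ , loop , ≃-sym X∼root)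
      where
      start : Pool (λ _ → ⊥) root []
      start = record
        { expand = λ ()
        ; distinct = λ ()
        ; off = λ ()
        ; fresh = λ ()
        ; route = λ { (named self) → here ≃-refl }
        ; anchor = named self
        }

      module R = Result (collapse w start self ≃-refl (λ _ ()) pr)
      open Pool R.isPool

      X = R.U * r

      X∼root : X ∼ root
      X∼root = ≃-sym (*-unique (≃-trans (sound (≈-sym (BKS1 _ _))) (∼-+-cong (≃-sym R.value) ≃-refl)))

      data D : State A → Set where
        done : D √
        loop : D (term X)
        body : p ∈ R.B′ → D (term (p · X))
        good : Good p → D (term p)

      target : ∀ {s} → Target R.B′ s → D (term (s ▸ X))
      target (name self) = loop
      target (name (pool i)) = body i
      target (exit x) = good (Exit.good (exit-· x))

      goodˢ : ∀ {s} → Goodˢ s → D s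
      goodˢ {√} _ = done
      goodˢ {term _} g = good g

      collapse-D : D (term p) → D (term q) → p ∼ q → p ≈ q
      collapse-D _ (good g) d = g stay d
      collapse-D (good g) _ d = ≈-sym (g stay (≃-sym d))
      collapse-D loop loop _ = ≈-refl
      collapse-D loop (body i) d = contradiction
        (≃-trans (∼-·-cong ≃-refl (≃-sym X∼root)) (≃-trans (≃-sym d) X∼root)) (off i)
      collapse-D (body i) loop d = contradiction
        (≃-trans (∼-·-cong ≃-refl (≃-sym X∼root)) (≃-trans d X∼root)) (off i)
      collapse-D (body i) (body j) d
        with refl ← distinct i j (≃-trans (∼-·-cong ≃-refl (≃-sym X∼root))
                                          (≃-trans d (∼-·-cong ≃-refl X∼root))) = ≈-refl

      collapsed : Collapsed D
      collapsed = record
        { done = done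
        ; expand = λ { loop → expands-≈ (BKS1 _ _)
                         (expands-+ (expands-▸ target R.expands) (expands-moves r (λ m → goodˢ (good-move m g))))
                     ; (body i) → expands-▸ target (expand i)
                     ; (good g) → expands-moves _ (λ m → goodˢ (good-move m g)) }
        ; collapse = collapse-D
        }

    -- Exits are good, so if one of them reaches a copy of the root, the root is good already.
    exits-avoid? : Wf GoodMute e → Good root ⊎ Wf Exit e
    exits-avoid? act = inj₂ act
    exits-avoid? (w ⊕ w′) with exits-avoid? w | exits-avoid? w′
    ... | inj₁ g | _ = inj₁ g
    ... | inj₂ _ | inj₁ g = inj₁ g
    ... | inj₂ w | inj₂ w′ = inj₂ (w ⊕ w′)
    exits-avoid? (_⊞_ {z = z} w (g , m)) with exits-avoid? w | some-reach? (_∼? root) z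
    ... | inj₁ g′ | _ = inj₁ g′
    ... | inj₂ _ | yes (_ , r , d) = inj₁ (good-∼ d (good-reach r g))
    ... | inj₂ w | no ¬r = inj₂ (w ⊞ record { good = g ; silent = m ; avoids = λ r d → ¬r (_ , r , d) })
    exits-avoid? (w ⊙ w′) with exits-avoid? w | exits-avoid? w′
    ... | inj₁ g | _ = inj₁ g
    ... | inj₂ _ | inj₁ g = inj₁ g
    ... | inj₂ w | inj₂ w′ = inj₂ (w ⊙ w′)
    exits-avoid? (w ⊛ w′) with exits-avoid? w | exits-avoid? w′
    ... | inj₁ g | _ = inj₁ g
    ... | inj₂ _ | inj₁ g = inj₁ g
    ... | inj₂ w | inj₂ w′ = inj₂ (w ⊛ w′)
    exits-avoid? (under-way i w w′) with exits-avoid? w | exits-avoid? w′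
    ... | inj₁ g | _ = inj₁ g
    ... | inj₂ _ | inj₁ g = inj₁ g
    ... | inj₂ w | inj₂ w′ = inj₂ (under-way i w w′)

  goodˢ-≃ : ∀ {s t} → s ≃ t → Goodˢ s → Goodˢ t
  goodˢ-≃ {t = √} _ _ = tt
  goodˢ-≃ {√} {term _} d _ = contradiction (≃-sym d) not-√
  goodˢ-≃ {term _} {term _} d g = good-∼ d g

  -- If the root is bisimilar to the state x in the body of an inner loop h = u * (v · root), then
  -- h ∼ u · h + v · (x · h), so h is itself an outermost loop, and its body has fewer stars to consider.
  good-* : ∀ {n} → Acc _<_ n → (∀ {u v} → Loop u v e → stars u ℕ.+ stars v < n) →
           Wf GoodMute e → Good r → Good (⟦ e ⟧ * r)
  good-* {e} {r} (acc rec) bound w g with exits-avoid? (⟦ e ⟧ * r) w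
  ... | inj₁ g′ = g′
  ... | inj₂ w′ with some-loop? e (λ u v → some-state? u (λ x →
                       (⟦ x ⟧ · (⟦ u ⟧ * (⟦ v ⟧ · (⟦ e ⟧ * r)))) ∼? (⟦ e ⟧ * r)))
  ... | no proper = good-root (⟦ e ⟧ * r) w′ g refl λ l i d → proper (_ , _ , l , _ , i , d)
  ... | yes (u , v , l , x , i , d) =
    -- `v` halts, so the root is reached from `h` through the exit of the loop and inherits its
    -- goodness.
    halts-▸ goodˢ-≃ (λ g m → good-move m g) (halts {v}) λ m → good-move (*-exit m) good-h
    where
    h : Term A
    h = ⟦ u ⟧ * (⟦ v ⟧ · (⟦ e ⟧ * r))

    h-outermost : h ∼ ⟦ u ⊕ v ⊙ x ⟧ * 𝟘
    h-outermost = *-unique (begin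
      h ≈⟨ sound (BKS1 _ _) ⟨
      ⟦ u ⟧ · h + ⟦ v ⟧ · (⟦ e ⟧ * r) ≈⟨ ∼-+-cong ≃-refl (∼-·-cong ≃-refl d) ⟨
      ⟦ u ⟧ · h + ⟦ v ⟧ · (⟦ x ⟧ · h) ≈⟨ sound (+-cong ≈-refl (B5 _ _ _)) ⟨
      ⟦ u ⟧ · h + (⟦ v ⟧ · ⟦ x ⟧) · h ≈⟨ sound (B4 _ _ _) ⟨
      ⟦ u ⊕ v ⊙ x ⟧ · h ≈⟨ sound (B6 _) ⟨
      ⟦ u ⊕ v ⊙ x ⟧ · h + 𝟘 ∎)
      where open ∼-Reasoning

    -- The measure bounds the single loops of the body, not its `stars`: the new body counts `u` and
    -- `x` together and may have more stars than `e`. A loop in `v` is now followed by `x`, which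
    -- has at most the stars of `u`; a loop in `x` is a loop in `u`.
    bound′ : ∀ {u′ v′} → Loop u′ v′ (u ⊕ v ⊙ x) → stars u′ ℕ.+ stars v′ < stars u ℕ.+ stars v
    bound′ (⊕ˡ l′) = ℕ.m≤n⇒m≤n+o _ (stars-loop l′)
    bound′ {u′} (⊕ʳ (⊙ˡ {v = v′} l′)) = begin-strict
      stars u′ ℕ.+ (stars v′ ℕ.+ stars x) ≡⟨ ℕ.+-assoc (stars u′) (stars v′) (stars x) ⟨
      stars u′ ℕ.+ stars v′ ℕ.+ stars x <⟨ ℕ.+-mono-<-≤ (stars-loop l′) (stars-state i) ⟩
      stars v ℕ.+ stars u ≡⟨ ℕ.+-comm (stars v) (stars u) ⟩
      stars u ℕ.+ stars v ∎
      where open ℕ.≤-Reasoning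
    bound′ (⊕ʳ (⊙ʳ l′)) = ℕ.m≤n⇒m≤n+o _ (stars-loop (loop-state i l′))

    good-h : Good h
    good-h =
      let wu , wv = wf-loop w l
      in good-∼ (≃-sym h-outermost) (good-* (rec (bound l)) bound′ (wu ⊕ (wv ⊙ wf-state wu i)) good-𝟘)

  -- Goodness is passed from the continuation back through the expression, with the loops handled by
  -- `good-*`; the case `√` gives goodness of the expression itself.
  good-▹ : Wf GoodMute e → Goodˢ s → Good (⟦ e ⟧ ▹ s)
  good-▹ {s = √} act _ = good-next λ { act-done → tt }
  good-▹ {s = term _} act g = good-next λ { (·-done act-done) → g }
  good-▹ {s = s} (w ⊕ w′) g = good-∼ (sound (≈-sym (▹-+ s))) (good-+ (good-▹ w g) (good-▹ w′ g))
  good-▹ {s = s} (_⊞_ {z = z} w (g′ , m)) g =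
    good-∼ (sound (≈-sym (▹-+ s))) (good-+ (good-▹ w g) (good-∼ (absorbs s) g′))
    where
    absorbs : ∀ s → z ∼ z ▹ s
    absorbs √ = ≃-refl
    absorbs (term k) = ≃-sym (mute-· m)
  good-▹ {s = s} (w ⊙ w′) g = good-∼ (sound (≈-sym (▹-· s))) (good-▹ {s = term _} w (good-▹ w′ g))
  good-▹ {s = s} (w ⊛ w′) g =
    good-∼ (sound (≈-sym (▹-* s))) (good-* (<-wellFounded _) stars-loop w (good-▹ w′ g))
  good-▹ {s = s} (under-way _ w w′) g = good-∼ (sound (≈-sym (▹-· s))) (good-▹ {s = term _} w (good-▹ w′ g))

  goodMute-+ : GoodMute p → GoodMute q → GoodMute (p + q)
  goodMute-+ (g , m) (g′ , m′) = good-+ g g′ , ≃-trans (sound (B4 _ _ _)) (∼-+-cong m m′)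

  goodMute-≈ : p ≈ q → GoodMute p → GoodMute q
  goodMute-≈ e (g , m) = good-∼ (sound e) g , ≃-trans (sound (·-cong (≈-sym e) ≈-refl)) (≃-trans m (sound e))

  -- Goodness makes `p` rigid, which turns this bisimilarity into a provable equality.
  goodMute-· : GoodMute p → p · q ≈ p
  goodMute-· (g , m) = g stay (mute-· m)

  Classified : Term A → Set
  Classified p = (∃[ e ] (Wf GoodMute e × p ≈ ⟦ e ⟧)) ⊎ GoodMute p

  classified-≈ : p ≈ q → Classified p → Classified q
  classified-≈ d (inj₁ (e , w , d′)) = inj₁ (e , w , ≈-trans (≈-sym d) d′)
  classified-≈ d (inj₂ m) = inj₂ (goodMute-≈ d m)

  classified-+ : Classified p → Classified q → Classified (p + q)
  classified-+ (inj₁ (_ , w , d)) (inj₁ (_ , w′ , d′)) = inj₁ (_ , w ⊕ w′ , +-cong d d′)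
  classified-+ (inj₁ (_ , w , d)) (inj₂ m) = inj₁ (_ , w ⊞ m , +-cong d ≈-refl)
  classified-+ (inj₂ m) (inj₁ (_ , w , d)) = inj₁ (_ , w ⊞ m , ≈-trans (B1 _ _) (+-cong d ≈-refl))
  classified-+ (inj₂ m) (inj₂ m′) = inj₂ (goodMute-+ m m′)

  -- Mute parts are pushed into summands: a mute first factor absorbs the second, a mute second
  -- factor or exit makes the whole mute, and a star with a mute body is a sum. Mute terms are shown
  -- to be good along the way, since the exits of later expressions have to be good.
  classify : ∀ p → Classified p
  classify 𝟘 = inj₂ (good-𝟘 , sound (B7 _))
  classify (act a) = inj₁ (act a , act , ≈-refl)
  classify (p + q) = classified-+ (classify p) (classify q)
  classify (p · q) with classify p | classify q
  ... | inj₂ m | _ = inj₂ (goodMute-≈ (≈-sym (goodMute-· m)) m)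
  ... | inj₁ (_ , w , d) | inj₁ (_ , w′ , d′) = inj₁ (_ , w ⊙ w′ , ·-cong d d′)
  ... | inj₁ (_ , w , d) | inj₂ (g , m) = inj₂
    ( good-∼ (sound (·-cong (≈-sym d) ≈-refl)) (good-▹ {s = term _} w g)
    , ≃-trans (sound (B5 _ _ _)) (∼-·-cong ≃-refl m) )
  classify (p * q) with classify p | classify q
  ... | inj₂ m | c = classified-≈
    (≈-trans (+-cong (≈-sym (goodMute-· m)) ≈-refl) (BKS1 _ _)) (classified-+ (inj₂ m) c)
  ... | inj₁ (_ , w , d) | inj₁ (_ , w′ , d′) = inj₁ (_ , w ⊛ w′ , *-cong d d′)
  ... | inj₁ (_ , w , d) | inj₂ (g , m) = inj₂
    ( good-∼ (sound (*-cong (≈-sym d) ≈-refl)) (good-* (<-wellFounded _) stars-loop w g)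
    , ≃-trans (sound (BKS2 _ _ _)) (∼-*-cong ≃-refl m) )

  good : ∀ p → Good p
  good p with classify p
  ... | inj₁ (_ , w , d) = good-∼ (sound (≈-sym d)) (good-▹ {s = √} w tt)
  ... | inj₂ (g , _) = g

  complete : p ∼ q → p ≈ q
  complete {q = q} = good q stay

-- Renaming of actions.

module _ {ℓ ℓ′ : Level} {A : Set ℓ} {B : Set ℓ′} (f : A → B) where

  rename : Term A → Term B
  rename 𝟘 = 𝟘
  rename (act a) = act (f a)
  rename (p + q) = rename p + rename q
  rename (p · q) = rename p · rename q
  rename (p * q) = rename p * rename q

  renameˢ : State A → State B
  renameˢ √ = √
  renameˢ (term p) = term (rename p)

  rename-≈ : ∀ {p q} → p ≈ q → rename p ≈ rename q
  rename-≈ ≈-refl = ≈-refl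
  rename-≈ (≈-sym e) = ≈-sym (rename-≈ e)
  rename-≈ (≈-trans e e′) = ≈-trans (rename-≈ e) (rename-≈ e′)
  rename-≈ (+-cong e e′) = +-cong (rename-≈ e) (rename-≈ e′)
  rename-≈ (·-cong e e′) = ·-cong (rename-≈ e) (rename-≈ e′)
  rename-≈ (*-cong e e′) = *-cong (rename-≈ e) (rename-≈ e′)
  rename-≈ (B1 x y) = B1 _ _
  rename-≈ (B2 x y z) = B2 _ _ _
  rename-≈ (B3 x) = B3 _
  rename-≈ (B4 x y z) = B4 _ _ _
  rename-≈ (B5 x y z) = B5 _ _ _
  rename-≈ (B6 x) = B6 _
  rename-≈ (B7 x) = B7 _
  rename-≈ (BKS1 x y) = BKS1 _ _
  rename-≈ (BKS2 x y z) = BKS2 _ _ _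
  rename-≈ (RSP e) = RSP (rename-≈ e)

  rename-move : ∀ {p a v} → term p ⟶[ a ] v → term (rename p) ⟶[ f a ] renameˢ v
  rename-move act-done = act-done
  rename-move (+-left m) = +-left (rename-move m)
  rename-move (+-right m) = +-right (rename-move m)
  rename-move (·-step m) = ·-step (rename-move m)
  rename-move (·-done m) = ·-done (rename-move m)
  rename-move (*-step m) = *-step (rename-move m)
  rename-move (*-loop m) = *-loop (rename-move m)
  rename-move (*-exit m) = *-exit (rename-move m)

  -- Indexed by label and target, so that matching exposes both as images under `f`.
  data RenamedMove (p : Term A) : B → State B → Set (ℓ ⊔ ℓ′) where
    renamed : ∀ {a v} → term p ⟶[ a ] v → RenamedMove p (f a) (renameˢ v)

  rename-inv : ∀ p {b w} → term (rename p) ⟶[ b ] w → RenamedMove p b w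
  rename-inv (act a) act-done = renamed act-done
  rename-inv (p + q) (+-left m) with renamed m′ ← rename-inv p m = renamed (+-left m′)
  rename-inv (p + q) (+-right m) with renamed m′ ← rename-inv q m = renamed (+-right m′)
  rename-inv (p · q) m with ·-inv m
  ... | move m′ with rename-inv p m′
  ... | renamed {v = √} m″ = renamed (·-done m″)
  ... | renamed {v = term _} m″ = renamed (·-step m″)
  rename-inv (p * q) m with *-inv m
  ... | exit m′ with renamed m″ ← rename-inv q m′ = renamed (*-exit m″)
  ... | body m′ with rename-inv p m′
  ... | renamed {v = √} m″ = renamed (*-loop m″)
  ... | renamed {v = term _} m″ = renamed (*-step m″)

module _ {ℓ ℓ′ ℓ″ : Level} {A : Set ℓ} {B : Set ℓ′} {C : Set ℓ″} {f : B → C} {g : A → B} {h : A → C} where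

  rename-∘ : (∀ a → f (g a) ≡ h a) → ∀ p → rename f (rename g p) ≡ rename h p
  rename-∘ e 𝟘 = refl
  rename-∘ e (act a) = cong act (e a)
  rename-∘ e (p + q) = cong₂ _+_ (rename-∘ e p) (rename-∘ e q)
  rename-∘ e (p · q) = cong₂ _·_ (rename-∘ e p) (rename-∘ e q)
  rename-∘ e (p * q) = cong₂ _*_ (rename-∘ e p) (rename-∘ e q)

-- Reduction to finitely many labels with decidable equality.

module _ {ℓ : Level} {A : Set ℓ} where

  Collision : ∀ {n} → (Fin n → A) → Set ℓ
  Collision f = ∃[ i ] ∃[ j ] (¬ i ≡ j × f i ≡ f j)

  all-or : ∀ {c} {X : Set} {Q : X → Set} {C : Set c} xs → (∀ {x} → x ∈ xs → Q x ⊎ C) → All Q xs ⊎ C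
  all-or [] f = inj₁ []
  all-or (x ∷ xs) f with f (here refl) | all-or xs (f ∘ there)
  ... | inj₁ q | inj₁ qs = inj₁ (q ∷ qs)
  ... | inj₁ _ | inj₂ c = inj₂ c
  ... | inj₂ c | _ = inj₂ c

  module _ {R : Rel (State A) ℓ} (bisim : IsBisimulation R) {m : ℕ} (f : Fin m → A) where

    open IsBisimulation bisim renaming (forth to forthᴿ; back to backᴿ)

    -- The bisimulation `R` answers moves over `A`. If an answer carries a different label with the
    -- same action, it exhibits a collision; otherwise it is an answer over the labels, and the
    -- exploration continues to depth `n`.
    explore : ∀ n {s t} → R (renameˢ f s) (renameˢ f t) → s ~[ n ] t ⊎ Collision f
    explore zero r = inj₁ any
    explore (suc n) {√} {√} r = inj₁ stop
    explore (suc n) {√} {term q} r with () ← Equivalence.to (termination r) refl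
    explore (suc n) {term p} {√} r with () ← Equivalence.from (termination r) refl
    explore (suc n) {term p} {term q} r = combine (all-or (moves p) to) (all-or (moves q) from)
      where
      To From : Fin m × State (Fin m) → Set
      To (a , v) = ∃[ w ] (term q ⟶[ a ] w × v ~[ n ] w)
      From (b , w) = ∃[ v ] (term p ⟶[ b ] v × v ~[ n ] w)

      answer-to : ∀ {a v b w} → RenamedMove f q b w → f a ≡ b → R (renameˢ f v) w → To (a , v) ⊎ Collision f
      answer-to {a} (renamed {b} m) e r′ with a Fin.≟ b
      ... | no a≢b = inj₂ (_ , _ , a≢b , e)
      ... | yes refl = Sum.map₁ (λ c → _ , m , c) (explore n r′)

      to : ∀ {av} → av ∈ moves p → To av ⊎ Collision f
      to i = let _ , m , r′ = forthᴿ r (rename-move f (moves-sound p i)) in answer-to (rename-inv f q m) refl r′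

      answer-from : ∀ {b w a v} → RenamedMove f p a v → f b ≡ a → R v (renameˢ f w) → From (b , w) ⊎ Collision f
      answer-from {b} (renamed {a} m) e r′ with b Fin.≟ a
      ... | no b≢a = inj₂ (_ , _ , b≢a , e)
      ... | yes refl = Sum.map₁ (λ c → _ , m , c) (explore n r′)

      from : ∀ {bw} → bw ∈ moves q → From bw ⊎ Collision f
      from i = let _ , m , r′ = backᴿ r (rename-move f (moves-sound q i)) in answer-from (rename-inv f p m) refl r′

      combine : All To (moves p) ⊎ Collision f → All From (moves q) ⊎ Collision f →
                term p ~[ suc n ] term q ⊎ Collision f
      combine (inj₁ all) (inj₁ all′) = inj₁ (step
        (λ m → All.lookup all (moves-complete m)) (λ m → All.lookup all′ (moves-complete m)))
      combine (inj₁ _) (inj₂ c) = inj₂ c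
      combine (inj₂ c) _ = inj₂ c

  module _ {m : ℕ} {i j : Fin (suc m)} (i≢j : ¬ i ≡ j) where

    -- The label `i` is dropped in favour of `j`. As `f` agrees on the two, no action is lost.
    merge : Fin (suc m) → Fin m
    merge k with i Fin.≟ k
    ... | yes _ = punchOut i≢j
    ... | no i≢k = punchOut i≢k

    merge-punchIn : (f : Fin (suc m) → A) → f i ≡ f j → ∀ k → f (punchIn i (merge k)) ≡ f k
    merge-punchIn f e k with i Fin.≟ k
    ... | yes refl = trans (cong f (Fin.punchIn-punchOut i≢j)) (sym e)
    ... | no i≢k = cong f (Fin.punchIn-punchOut i≢k)

  module _ {R : Rel (State A) ℓ} (bisim : IsBisimulation R) where

    -- Equality in A need not be decidable, so p and q carry labels in Fin n. A failure of bisimilarity at the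
    -- level of labels makes R identify two distinct labels, which are then merged.
    labelled-complete : ∀ n (f : Fin n → A) p q → R (term (rename f p)) (term (rename f q)) →
                        rename f p ≈ rename f q
    labelled-complete n f p q r with Decidability.bisimilar-or-separated Fin._≟_ p q
    ... | inj₁ e = rename-≈ f (Completeness.complete Fin._≟_ e)
    ... | inj₂ (m , ¬e) with explore bisim f m r
    ... | inj₁ e = contradiction e ¬e
    labelled-complete (suc n) f p q r | inj₂ _ | inj₂ (i , j , i≢j , e) =
      subst₂ _≈_ (merged p) (merged q) (labelled-complete n (f ∘ punchIn i) (rename g p) (rename g q)
        (subst₂ (λ p q → R (term p) (term q)) (sym (merged p)) (sym (merged q)) r))
      where
      g : Fin (suc n) → Fin n
      g = merge i≢j

      merged : ∀ p → rename (f ∘ punchIn i) (rename g p) ≡ rename f p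
      merged = rename-∘ (merge-punchIn i≢j f e)

  data Labelled : Term A → Set ℓ where
    labelled : ∀ {n} (f : Fin n → A) p → Labelled (rename f p)

  data Labelled₂ : Term A → Term A → Set ℓ where
    labelled₂ : ∀ {n} (f : Fin n → A) p q → Labelled₂ (rename f p) (rename f q)

  -- The two sets of labels are put side by side without comparing actions, so one action may get
  -- several labels. This is how collisions arise.
  pair : ∀ {p q} → Labelled p → Labelled q → Labelled₂ p q
  pair (labelled {m} f p) (labelled {n} g q) =
    subst₂ Labelled₂
      (rename-∘ (λ i → cong [ f , g ]′ (Fin.splitAt-↑ˡ m i n)) p)
      (rename-∘ (λ i → cong [ f , g ]′ (Fin.splitAt-↑ʳ m n i)) q)
      (labelled₂ ([ f , g ]′ ∘ splitAt m) (rename (_↑ˡ n) p) (rename (m ↑ʳ_) q))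

  label : ∀ p → Labelled p
  label 𝟘 = labelled {n = 0} (λ ()) 𝟘
  label (act a) = labelled {n = 1} (λ _ → a) (act zero)
  label (p + q) with labelled₂ f p q ← pair (label p) (label q) = labelled f (p + q)
  label (p · q) with labelled₂ f p q ← pair (label p) (label q) = labelled f (p · q)
  label (p * q) with labelled₂ f p q ← pair (label p) (label q) = labelled f (p * q)

theorem1 : {ℓ : Level} {A : Set ℓ} (p q : Term A) → term p ↔ term q → p ≈ q
theorem1 p q (R , bisim , r) with labelled₂ f p q ← pair (label p) (label q) =
  labelled-complete bisim _ f p q r
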